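{- There exists a polynomial-time algorithm which, given input $(A,b)$, where $A=(a_{11},\ldots,a_{1n})\in\mathbb{Z}^{1\times n}_{>0}$, $n\ge 2$, satisfies (i) $\gcd(a_{11},\ldots,a_{1n})=1$, (ii) $\{\boldsymbol{x}\in\mathbb{R}^n_{\ge 0}: A\boldsymbol{x}=0\}=\{\boldsymbol{0}\}$, and $b\in\mathbb{Z}$ satisfies $b>G(A)$, computes a nonnegative integer solution $\boldsymbol{x}\in\mathbb{Z}^n_{\ge 0}$ to the equation $A\boldsymbol{x}=b$.
   Context: The dimension $n$ is part of the input (not fixed). Polynomial time means polynomial in the binary encoding size of the input $(A,b)$. Set $f_1=a_{11}$ and $f_i=\gcd(a_{11},\ldots,a_{1i})$ for $i\in\{2,\ldots,n\}$. Then $$G(A):=a_{12}\frac{f_1}{f_2}+a_{13}\frac{f_2}{f_3}+\cdots+a_{1n}\frac{f_{n-1}}{f_n}-\sum_{i=1}^n a_{1i}.$$ -}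

module Defs where

open import Algebra.Bundles using (CommutativeMonoid)
open import Algebra.Bundles.Raw using (RawMonoid)
import Algebra.Definitions.RawMonoid as RawMonoidDefs
import Algebra.Properties.CommutativeSemigroup as CommutativeSemigroupProperties
open import Data.Bool.Base using (if_then_else_)
open import Data.Fin.Base as Fin using (Fin; Fin′; toℕ; inject₁; inject!)
open import Data.Integer.Base as ℤ using (ℤ; +_; +[1+_]; -[1+_]; 0ℤ; ∣_∣)
open import Data.Integer.GCD using (gcd)
open import Data.List.Base as List using (List; []; _∷_; _∷ʳ_; length; lookup)
open import Data.Nat.Base as ℕ using (ℕ; zero; suc; _≡ᵇ_; _⊔_)
import Data.Nat.Properties as ℕₚ
open import Data.Nat.ListAction using (sum)
open import Data.Nat.Logarithm using (⌈log₂_⌉)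
open import Data.Product using (∃-syntax; _×_; _,_; proj₁; proj₂)
open import Data.Rational.Base as ℚ using (ℚ; 0ℚ; 1ℚ; ½; Positive)
import Data.Rational.Properties as ℚₚ
open import Data.Vec.Functional as Vector using (Vector; foldr; zipWith; toList)
open import Function.Bundles using (_⇔_)
open import Relation.Binary.PropositionalEquality
  using (_≡_; sym; trans; cong; subst)

-- Cauchy sequences of rationals. Equality of reals is _≈ᴿ_.

record ℝ : Set where
  constructor mkℝ
  field
    seq    : ℕ → ℚ
    cauchy : ∀ ε → Positive ε →
             ∃[ N ] ∀ m n → N ℕ.≤ m → N ℕ.≤ n → ℚ.∣ seq m ℚ.- seq n ∣ ℚ.< ε

open ℝ public

infix 4 _≈ᴿ_ _≤ᴿ_

_≈ᴿ_ : ℝ → ℝ → Set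
x ≈ᴿ y = ∀ ε → Positive ε →
         ∃[ N ] ∀ n → N ℕ.≤ n → ℚ.∣ seq x n ℚ.- seq y n ∣ ℚ.< ε

_≤ᴿ_ : ℝ → ℝ → Set
x ≤ᴿ y = ∀ ε → Positive ε →
         ∃[ N ] ∀ n → N ℕ.≤ n → seq x n ℚ.< seq y n ℚ.+ ε

0ᴿ : ℝ
0ᴿ = mkℝ (λ _ → 0ℚ) λ ε ε>0 → 0 , λ _ _ _ _ → ℚₚ.positive⁻¹ ε {{ε>0}}

infixl 6 _+ᴿ_
infixl 7 _·ᴿ_

_+ᴿ_ : ℝ → ℝ → ℝ
x +ᴿ y = mkℝ (λ k → seq x k ℚ.+ seq y k) sumCauchy
  where
  regroup : ∀ a b c d → (a ℚ.+ b) ℚ.- (c ℚ.+ d) ≡ (a ℚ.- c) ℚ.+ (b ℚ.- d)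
  regroup a b c d =
    trans (cong ((a ℚ.+ b) ℚ.+_) (ℚₚ.neg-distrib-+ c d))
      (interchange a b (ℚ.- c) (ℚ.- d))
    where
    open CommutativeSemigroupProperties
      (CommutativeMonoid.commutativeSemigroup ℚₚ.+-0-commutativeMonoid)

  halves : ∀ ε → ε ℚ.* ½ ℚ.+ ε ℚ.* ½ ≡ ε
  halves ε = trans (sym (ℚₚ.*-distribˡ-+ ε ½ ½)) (ℚₚ.*-identityʳ ε)

  sumCauchy : ∀ ε → Positive ε → ∃[ N ] ∀ m n → N ℕ.≤ m → N ℕ.≤ n →
    ℚ.∣ (seq x m ℚ.+ seq y m) ℚ.- (seq x n ℚ.+ seq y n) ∣ ℚ.< ε
  sumCauchy ε ε>0 = proj₁ cx ⊔ proj₁ cy , bound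
    where
    ε/2>0 : Positive (ε ℚ.* ½)
    ε/2>0 = ℚₚ.pos*pos⇒pos ε {{ε>0}} ½
    cx = cauchy x (ε ℚ.* ½) ε/2>0
    cy = cauchy y (ε ℚ.* ½) ε/2>0
    bound : ∀ m n → proj₁ cx ⊔ proj₁ cy ℕ.≤ m → proj₁ cx ⊔ proj₁ cy ℕ.≤ n →
      ℚ.∣ (seq x m ℚ.+ seq y m) ℚ.- (seq x n ℚ.+ seq y n) ∣ ℚ.< ε
    bound m n N≤m N≤n = begin-strict
      ℚ.∣ (seq x m ℚ.+ seq y m) ℚ.- (seq x n ℚ.+ seq y n) ∣
        ≡⟨ cong ℚ.∣_∣ (regroup (seq x m) (seq y m) (seq x n) (seq y n)) ⟩
      ℚ.∣ (seq x m ℚ.- seq x n) ℚ.+ (seq y m ℚ.- seq y n) ∣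
        ≤⟨ ℚₚ.∣p+q∣≤∣p∣+∣q∣ (seq x m ℚ.- seq x n) (seq y m ℚ.- seq y n) ⟩
      ℚ.∣ seq x m ℚ.- seq x n ∣ ℚ.+ ℚ.∣ seq y m ℚ.- seq y n ∣
        <⟨ ℚₚ.+-mono-<
             (proj₂ cx m n (ℕₚ.m⊔n≤o⇒m≤o _ _ N≤m) (ℕₚ.m⊔n≤o⇒m≤o _ _ N≤n))
             (proj₂ cy m n (ℕₚ.m⊔n≤o⇒n≤o _ _ N≤m) (ℕₚ.m⊔n≤o⇒n≤o _ _ N≤n)) ⟩
      ε ℚ.* ½ ℚ.+ ε ℚ.* ½
        ≡⟨ halves ε ⟩
      ε ∎
      where open ℚₚ.≤-Reasoning

_·ᴿ_ : ℤ → ℝ → ℝ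
z ·ᴿ x = mkℝ (λ k → q ℚ.* seq x k) scaledCauchy
  where
  q : ℚ
  q = z ℚ./ 1

  factor : ∀ a b c → a ℚ.* b ℚ.- a ℚ.* c ≡ a ℚ.* (b ℚ.- c)
  factor a b c =
    trans (cong (a ℚ.* b ℚ.+_) (ℚₚ.neg-distribʳ-* a c))
      (sym (ℚₚ.*-distribˡ-+ a b (ℚ.- c)))

  r : ℚ
  r = 1ℚ ℚ.+ ℚ.∣ q ∣

  r>0 : Positive r
  r>0 = ℚₚ.pos+nonNeg⇒pos 1ℚ ℚ.∣ q ∣ {{ℚₚ.∣-∣-nonNeg q}}

  r≢0 : ℚ.NonZero r
  r≢0 = ℚₚ.pos⇒nonZero r {{r>0}}

  ∣q∣≤r : ℚ.∣ q ∣ ℚ.≤ r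
  ∣q∣≤r = subst (ℚ._≤ r) (ℚₚ.+-identityˡ ℚ.∣ q ∣)
    (ℚₚ.+-monoˡ-≤ ℚ.∣ q ∣ (ℚₚ.nonNegative⁻¹ 1ℚ))

  1/r : ℚ
  1/r = ℚ.1/_ r {{r≢0}}

  cancel : ∀ ε → r ℚ.* (1/r ℚ.* ε) ≡ ε
  cancel ε = trans (sym (ℚₚ.*-assoc r 1/r ε))
    (trans (cong (ℚ._* ε) (ℚₚ.*-inverseʳ r {{r≢0}})) (ℚₚ.*-identityˡ ε))

  scaledCauchy : ∀ ε → Positive ε → ∃[ N ] ∀ m n → N ℕ.≤ m → N ℕ.≤ n →
    ℚ.∣ q ℚ.* seq x m ℚ.- q ℚ.* seq x n ∣ ℚ.< ε
  scaledCauchy ε ε>0 = proj₁ cx , bound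
    where
    δ : ℚ
    δ = 1/r ℚ.* ε
    δ>0 : Positive δ
    δ>0 = ℚₚ.pos*pos⇒pos 1/r {{ℚₚ.1/pos⇒pos r {{r>0}}}} ε {{ε>0}}
    cx = cauchy x δ δ>0
    bound : ∀ m n → proj₁ cx ℕ.≤ m → proj₁ cx ℕ.≤ n →
      ℚ.∣ q ℚ.* seq x m ℚ.- q ℚ.* seq x n ∣ ℚ.< ε
    bound m n N≤m N≤n = begin-strict
      ℚ.∣ q ℚ.* seq x m ℚ.- q ℚ.* seq x n ∣
        ≡⟨ cong ℚ.∣_∣ (factor q (seq x m) (seq x n)) ⟩
      ℚ.∣ q ℚ.* (seq x m ℚ.- seq x n) ∣
        ≡⟨ ℚₚ.∣p*q∣≡∣p∣*∣q∣ q (seq x m ℚ.- seq x n) ⟩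
      ℚ.∣ q ∣ ℚ.* ℚ.∣ seq x m ℚ.- seq x n ∣
        ≤⟨ ℚₚ.*-monoʳ-≤-nonNeg _ {{ℚₚ.∣-∣-nonNeg (seq x m ℚ.- seq x n)}} ∣q∣≤r ⟩
      r ℚ.* ℚ.∣ seq x m ℚ.- seq x n ∣
        <⟨ ℚₚ.*-monoʳ-<-pos r {{r>0}} (proj₂ cx m n N≤m N≤n) ⟩
      r ℚ.* δ
        ≡⟨ cancel ε ⟩
      ε ∎
      where open ℚₚ.≤-Reasoning

+ᴿ-0-rawMonoid : RawMonoid _ _
+ᴿ-0-rawMonoid = record { _≈_ = _≈ᴿ_ ; _∙_ = _+ᴿ_ ; ε = 0ᴿ }

open RawMonoidDefs ℤ.+-0-rawMonoid public using () renaming (sum to sumℤ)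
open RawMonoidDefs +ᴿ-0-rawMonoid public using () renaming (sum to sumᴿ)

infix 7 _∙_ _∙ᴿ_

_∙_ : ∀ {n} → Vector ℤ n → Vector ℤ n → ℤ
A ∙ x = sumℤ (zipWith ℤ._*_ A x)

_∙ᴿ_ : ∀ {n} → Vector ℤ n → Vector ℝ n → ℝ
A ∙ᴿ x = sumᴿ (zipWith _·ᴿ_ A x)

-- { x ∈ ℝⁿ : x ≥ 0 , A x = 0 } = { 0 }
TrivialKernelCone : ∀ {n} → Vector ℤ n → Set
TrivialKernelCone {n} A = (x : Vector ℝ n) →
  ((∀ i → 0ᴿ ≤ᴿ x i) × A ∙ᴿ x ≈ᴿ 0ᴿ) ⇔ (∀ i → x i ≈ᴿ 0ᴿ)

gcdᵛ : ∀ {n} → Vector ℤ n → ℤ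
gcdᵛ = foldr gcd 0ℤ

-- The gcd of the entries with index at most i.
prefixGcd : ∀ {n} → Vector ℤ (suc n) → Fin (suc n) → ℤ
prefixGcd A i = gcdᵛ λ (j : Fin′ (Fin.suc i)) → A (inject! j)

infixl 7 _÷_

-- Integer division with nonnegative remainder, and i ÷ 0 = 0.
_÷_ : ℤ → ℤ → ℤ
i ÷ + zero     = 0ℤ
i ÷ j@(+[1+ _ ]) = i ℤ./ j
i ÷ j@(-[1+ _ ]) = i ℤ./ j

-- For positive A every prefixGcd is positive and the divisions are exact.
G : ∀ {n} → Vector ℤ (suc n) → ℤ
G {n} A =
  sumℤ {n} (λ i → A (Fin.suc i) ℤ.* (prefixGcd A (inject₁ i) ÷ prefixGcd A (Fin.suc i)))
  ℤ.- sumℤ A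

-- A sign bit plus the number of binary digits of ∣ z ∣.
bits : ℤ → ℕ
bits z = 1 ℕ.+ ⌈log₂ suc ∣ z ∣ ⌉

size : List ℤ → ℕ
size zs = sum (List.map bits zs)

encode : ∀ {n} → Vector ℤ n → ℤ → List ℤ
encode A b = toList A ∷ʳ b

-- Random access machine programs under the logarithmic cost criterion, with
-- structured control flow instead of jumps. A program has direct access to
-- registers and indirect access to an unbounded memory. Every operation is
-- charged the bit lengths of all its operands, including memory addresses, so
-- time is polynomially related to that of multitape Turing machines.

Reg : Set
Reg = ℕ

data Op : Set where
  add sub mul div : Op

infixr 5 _⨾_

data Program : Set where
  const          : Reg → ℤ → Program
  arith          : Op → Reg → Reg → Reg → Program
  load store     : Reg → Reg → Program
  _⨾_            : Program → Program → Program
  ifPos_then_else_ : Reg → Program → Program → Program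
  whilePos_loop_   : Reg → Program → Program

record State : Set where
  constructor ⟨_,_⟩
  field
    reg : Reg → ℤ
    mem : ℕ → ℤ

open State public

_[_↦_] : (ℕ → ℤ) → ℕ → ℤ → (ℕ → ℤ)
(f [ k ↦ v ]) j = if j ≡ᵇ k then v else f j

⟦_⟧ᵒ : Op → ℤ → ℤ → ℤ
⟦ add ⟧ᵒ = ℤ._+_
⟦ sub ⟧ᵒ = ℤ._-_
⟦ mul ⟧ᵒ = ℤ._*_
⟦ div ⟧ᵒ = _÷_

infix 3 _⊢_⇓_cost_

-- p ⊢ s ⇓ s′ cost t : started in s, the program p halts in s′ after time t.
-- A memory address is the absolute value of the register containing it.
data _⊢_⇓_cost_ : Program → State → State → ℕ → Set where
  const : ∀ {R M} r z →
    const r z ⊢ ⟨ R , M ⟩ ⇓ ⟨ R [ r ↦ z ] , M ⟩ cost bits z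
  arith : ∀ {R M} o r r₁ r₂ →
    arith o r r₁ r₂ ⊢ ⟨ R , M ⟩ ⇓ ⟨ R [ r ↦ ⟦ o ⟧ᵒ (R r₁) (R r₂) ] , M ⟩
      cost bits (R r₁) ℕ.+ bits (R r₂)
  load : ∀ {R M} r a →
    load r a ⊢ ⟨ R , M ⟩ ⇓ ⟨ R [ r ↦ M ∣ R a ∣ ] , M ⟩
      cost bits (R a) ℕ.+ bits (M ∣ R a ∣)
  store : ∀ {R M} a r →
    store a r ⊢ ⟨ R , M ⟩ ⇓ ⟨ R , M [ ∣ R a ∣ ↦ R r ] ⟩
      cost bits (R a) ℕ.+ bits (R r)
  _⨾_ : ∀ {p q s₀ s₁ s₂ t u} →
    p ⊢ s₀ ⇓ s₁ cost t → q ⊢ s₁ ⇓ s₂ cost u →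
    p ⨾ q ⊢ s₀ ⇓ s₂ cost t ℕ.+ u
  ifTrue : ∀ {r p q s s′ t} →
    0ℤ ℤ.< reg s r → p ⊢ s ⇓ s′ cost t →
    ifPos r then p else q ⊢ s ⇓ s′ cost bits (reg s r) ℕ.+ t
  ifFalse : ∀ {r p q s s′ t} →
    reg s r ℤ.≤ 0ℤ → q ⊢ s ⇓ s′ cost t →
    ifPos r then p else q ⊢ s ⇓ s′ cost bits (reg s r) ℕ.+ t
  whileTrue : ∀ {r p s₀ s₁ s₂ t u} →
    0ℤ ℤ.< reg s₀ r → p ⊢ s₀ ⇓ s₁ cost t → whilePos r loop p ⊢ s₁ ⇓ s₂ cost u →
    whilePos r loop p ⊢ s₀ ⇓ s₂ cost bits (reg s₀ r) ℕ.+ (t ℕ.+ u)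
  whileFalse : ∀ {r p s} →
    reg s r ℤ.≤ 0ℤ →
    whilePos r loop p ⊢ s ⇓ s cost bits (reg s r)

cells : List ℤ → ℕ → ℤ
cells []       _       = 0ℤ
cells (z ∷ _)  zero    = z
cells (_ ∷ zs) (suc k) = cells zs k

-- Input and output use the same convention: register 0 holds the length of
-- the list and the memory from address 0 on holds its entries.

initial : List ℤ → State
initial zs = ⟨ (λ _ → 0ℤ) [ 0 ↦ + length zs ] , cells zs ⟩

Contains : State → List ℤ → Set
Contains s zs = reg s 0 ≡ + length zs × (∀ i → mem s (toℕ i) ≡ lookup zs i)

_computes_from_within_ : Program → List ℤ → List ℤ → ℕ → Set
p computes out from inp within T =
  ∃[ s ] ∃[ t ] (p ⊢ initial inp ⇓ s cost t) × t ℕ.≤ T × Contains s out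

-- Coefficients, constant term first.
Polynomial : Set
Polynomial = List ℕ

eval : Polynomial → ℕ → ℕ
eval q n = List.foldr (λ c v → c ℕ.+ n ℕ.* v) 0 q

{-# OPTIONS --safe #-}

-- Let f j be the gcd of the first j + 1 coefficients. For i from the last index down to 1 the
-- residual right-hand side β is divisible by f i; the extended Euclidean algorithm gives v with
-- v aᵢ ≡ f i modulo f (i - 1), so x = (β / f i) v reduced modulo f (i - 1) / f i makes β - aᵢ x
-- divisible by f (i - 1). Finally a₀ divides β, and since every xᵢ is at most f (i - 1) / f i - 1,
-- the hypothesis G A < b says precisely that β > - a₀, whence x₀ = β / a₀ ≥ 0.
--
-- The program recomputes the prefix gcds for every i, so that its memory only ever holds
-- coefficients and finished coordinates. Bézout coefficients are reduced after every Euclidean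
-- step, hence all numbers involved are at most V ^ 8, where V = 2 ^ S and S is the input size.

module Submission where

open import Defs
open import Algebra.Properties.CommutativeMonoid.Sum using (∑-distrib-+)
open import Algebra.Properties.Monoid.Sum using (sum-init-last; sum-cong-≗)
open import Data.Bool.Base using (true; false)
open import Data.Empty using (⊥)
open import Data.Fin.Base as Fin using (Fin; toℕ)
open import Data.Fin.Properties using (toℕ-inject₁; toℕ-fromℕ; toℕ-fromℕ<; toℕ<n)
open import Data.Integer.Base as ℤ
  using (ℤ; +_; +[1+_]; -[1+_]; 0ℤ; 1ℤ; -1ℤ; ∣_∣; _<_; _≤_; _*_; _-_; _%ℕ_; +≤+; +<+)
import Data.Integer.DivMod as ℤᵈ
import Data.Integer.Properties as ℤₚ
open import Data.Integer.Tactic.RingSolver using (solve-∀)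
open import Data.List.Base using (List; []; _∷_; _++_; length; lookup)
open import Data.List.Properties using (length-tabulate)
open import Data.List.Relation.Unary.All using (All; []; _∷_)
open import Data.Nat.Base as ℕ using (ℕ; zero; suc; _+_; _^_; NonZero; z≤n; s≤s)
open import Data.Nat.DivMod as ℕᵈ using (_%_)
import Data.Nat.Divisibility as ℕ∣
import Data.Nat.GCD as ℕ
open import Data.Nat.Induction using (<-wellFounded)
open import Data.Nat.Logarithm using (⌈log₂_⌉; ⌈log₂⌉-mono-≤; ⌈log₂2^n⌉≡n)
import Data.Nat.Logarithm.Core as Log
import Data.Nat.Properties as ℕₚ
import Data.Nat.Tactic.RingSolver as ℕ-Ring
open import Data.Product using (Σ-syntax; ∃-syntax; _×_; _,_; proj₁; proj₂)
open import Data.Sum.Base using (inj₁; inj₂)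
open import Data.Unit using (⊤; tt)
open import Data.Vec.Functional using (Vector; toList)
open import Function.Base using (_∘_)
open import Induction.WellFounded using (Acc; acc)
open import Relation.Binary.PropositionalEquality
open import Relation.Nullary using (contradiction)
open import Relation.Nullary.Decidable using (True; toWitness)

-- Straight-line programs and their exact cost

-- Without branches or loops the final state and the charged operands are functions of the start
-- state, so facts about program bodies hold by evaluation.
Straight : Program → Set
Straight (const _ _)     = ⊤
Straight (arith _ _ _ _) = ⊤
Straight (load _ _)      = ⊤
Straight (store _ _)     = ⊤
Straight (p ⨾ q)         = Straight p × Straight q
Straight _               = ⊥

exec : Program → State → State
exec (const r z)       s = ⟨ reg s [ r ↦ z ] , mem s ⟩
exec (arith o r r₁ r₂) s = ⟨ reg s [ r ↦ ⟦ o ⟧ᵒ (reg s r₁) (reg s r₂) ] , mem s ⟩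
exec (load r a)        s = ⟨ reg s [ r ↦ mem s ∣ reg s a ∣ ] , mem s ⟩
exec (store a r)       s = ⟨ reg s , mem s [ ∣ reg s a ∣ ↦ reg s r ] ⟩
exec (p ⨾ q)           s = exec q (exec p s)
-- Default for branches and loops, which `Straight` excludes.
exec _                 s = s

operands : Program → State → List ℤ
operands (const r z)       s = z ∷ []
operands (arith o r r₁ r₂) s = reg s r₁ ∷ reg s r₂ ∷ []
operands (load r a)        s = reg s a ∷ mem s ∣ reg s a ∣ ∷ []
operands (store a r)       s = reg s a ∷ reg s r ∷ []
operands (p ⨾ q)           s = operands p s ++ operands q (exec p s)
operands _                 s = []

size-++ : ∀ xs ys → size (xs ++ ys) ≡ size xs + size ys
size-++ []       ys = refl
size-++ (x ∷ xs) ys = trans (cong (bits x ℕ.+_) (size-++ xs ys)) (sym (ℕₚ.+-assoc (bits x) _ _))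

retime : ∀ {p s s′ t u} → p ⊢ s ⇓ s′ cost t → t ≡ u → p ⊢ s ⇓ s′ cost u
retime run refl = run

run-straight : ∀ p {_ : Straight p} s → p ⊢ s ⇓ exec p s cost size (operands p s)
run-straight (const r z) s =
  retime (const {reg s} {mem s} r z) (sym (ℕₚ.+-identityʳ _))
run-straight (arith o r r₁ r₂) s =
  retime (arith {reg s} {mem s} o r r₁ r₂) (cong (bits (reg s r₁) ℕ.+_) (sym (ℕₚ.+-identityʳ _)))
run-straight (load r a) s =
  retime (load {reg s} {mem s} r a) (cong (bits (reg s a) ℕ.+_) (sym (ℕₚ.+-identityʳ _)))
run-straight (store a r) s =
  retime (store {reg s} {mem s} a r) (cong (bits (reg s a) ℕ.+_) (sym (ℕₚ.+-identityʳ _)))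
run-straight (p ⨾ q) {sp , sq} s =
  retime (run-straight p {sp} s ⨾ run-straight q {sq} (exec p s)) (sym (size-++ (operands p s) _))

-- Integer division: remainders, exactness and size

-- The machine has no remainder instruction; its programs form this difference instead.
÷-rem : ∀ i k → i - (i ÷ +[1+ k ]) * +[1+ k ] ≡ + (i %ℕ suc k)
÷-rem i k = begin
  i - (i ÷ +[1+ k ]) * +[1+ k ]
    ≡⟨ cong (ℤ._- (i ÷ +[1+ k ]) * +[1+ k ]) (ℤᵈ.a≡a%n+[a/n]*n i +[1+ k ]) ⟩
  (+ (i %ℕ suc k) ℤ.+ (i ÷ +[1+ k ]) * +[1+ k ]) - (i ÷ +[1+ k ]) * +[1+ k ]
    ≡⟨ cancel (+ (i %ℕ suc k)) ((i ÷ +[1+ k ]) * +[1+ k ]) ⟩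
  + (i %ℕ suc k) ∎
  where
  open ≡-Reasoning
  cancel : ∀ x y → (x ℤ.+ y) - y ≡ x
  cancel = solve-∀

÷-exact : ∀ q k → (q * +[1+ k ]) ÷ +[1+ k ] ≡ q
÷-exact q k = ℤₚ.*-cancelʳ-≡ _ _ +[1+ k ] (begin
  (q * d ÷ d) * d           ≡⟨ flip-sub (q * d) _ ⟩
  q * d - (q * d - (q * d ÷ d) * d)  ≡⟨ cong (ℤ._-_ (q * d)) (trans (÷-rem (q * d) k) (cong +_ rem0)) ⟩
  q * d - 0ℤ                ≡⟨ ℤₚ.+-identityʳ _ ⟩
  q * d                     ∎)
  where
  open ≡-Reasoning
  d = +[1+ k ]
  flip-sub : ∀ x y → y ≡ x - (x - y)
  flip-sub = solve-∀
  -- Hence the remainder vanishes: it is a multiple of d below d.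
  mult : + (q * d %ℕ suc k) ≡ (q - (q * d ÷ d)) * d
  mult = trans (sym (÷-rem (q * d) k)) (distrib q (q * d ÷ d) d)
    where
    distrib : ∀ q w d → q * d - w * d ≡ (q - w) * d
    distrib = solve-∀
  rem0 : q * d %ℕ suc k ≡ 0
  rem0 with q * d %ℕ suc k | mult | ℤᵈ.n%ℕd<d (q * d) (suc k)
  ... | zero  | _ | _  = refl
  ... | suc r | e | lt = contradiction
    (ℕ∣.∣⇒≤ (ℕ∣.divides ∣ q - (q * d ÷ d) ∣ (trans (cong ∣_∣ e) (ℤₚ.abs-* (q - (q * d ÷ d)) d))))
    (ℕₚ.<⇒≱ lt)

÷-cancel : ∀ z {k} → 0 ℕ.< k → (z * + k) ÷ + k ≡ z
÷-cancel z {suc k} _ = ÷-exact z k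

∣/ℕ∣≤ : ∀ i k → ∣ i ℤ./ℕ suc k ∣ ℕ.≤ ∣ i ∣
∣/ℕ∣≤ (+ n)    k = ℕᵈ.m/n≤m n (suc k)
∣/ℕ∣≤ -[1+ n ] k with suc n % suc k in rem
... | zero  = subst (ℕ._≤ suc n) (sym (ℤₚ.∣-i∣≡∣i∣ (+ (suc n ℕᵈ./ suc k)))) (ℕᵈ.m/n≤m (suc n) (suc k))
-- Rounding down a negative quotient adds one to its absolute value; the nonzero remainder pays for
-- it.
... | suc r = begin
  suc q                         ≤⟨ s≤s (ℕₚ.m≤m*n q (suc k)) ⟩
  suc (q ℕ.* suc k)             ≤⟨ s≤s (ℕₚ.m≤n+m _ r) ⟩
  suc r + q ℕ.* suc k           ≡⟨ cong (ℕ._+ q ℕ.* suc k) rem ⟨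
  suc n % suc k + q ℕ.* suc k   ≡⟨ ℕᵈ.m≡m%n+[m/n]*n (suc n) (suc k) ⟨
  suc n                         ∎
  where
  open ℕₚ.≤-Reasoning
  q = suc n ℕᵈ./ suc k

-- Valid for every divisor, zero and negative ones included, so bounding a quotient takes no
-- information about the divisor.
∣÷∣≤ : ∀ i j → ∣ i ÷ j ∣ ℕ.≤ ∣ i ∣
∣÷∣≤ i (+ zero) = z≤n
∣÷∣≤ i +[1+ k ] = subst (ℕ._≤ ∣ i ∣) (cong ∣_∣ (sym (ℤₚ.*-identityˡ (i ℤ./ℕ suc k)))) (∣/ℕ∣≤ i k)
∣÷∣≤ i -[1+ k ] = subst (ℕ._≤ ∣ i ∣)
  (sym (trans (cong ∣_∣ (ℤₚ.-1*i≡-i (i ℤ./ℕ suc k))) (ℤₚ.∣-i∣≡∣i∣ (i ℤ./ℕ suc k)))) (∣/ℕ∣≤ i k)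

-- Halting runs with a time budget

-- Time is counted in operands, each of which costs at most L.
module Timed (L : ℕ) where

  -- A total-correctness triple: halting, a budget of `n` operands and a postcondition in one
  -- package.
  record Runs (p : Program) (s : State) (n : ℕ) (Q : State → Set) : Set where
    constructor runs
    field
      {end}  : State
      {time} : ℕ
      run    : p ⊢ s ⇓ end cost time
      time≤  : time ℕ.≤ n ℕ.* L
      ends   : Q end

  record Small (z : ℤ) : Set where
    constructor mkSmall
    field bits≤ : bits z ℕ.≤ L

  open Small public

  runs-⇒ : ∀ {p s m n P Q} → m ℕ.≤ n → (∀ {s′} → P s′ → Q s′) → Runs p s m P → Runs p s n Q
  runs-⇒ m≤n P⇒Q (runs run t≤ Ps′) = runs run (ℕₚ.≤-trans t≤ (ℕₚ.*-monoˡ-≤ L m≤n)) (P⇒Q Ps′)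

  runs-straight : ∀ p {_ : Straight p} {s} →
    All Small (operands p s) → Runs p s (length (operands p s)) (_≡ exec p s)
  runs-straight p {straight} {s} small = runs (run-straight p {straight} s) (total small) refl
    where
    total : ∀ {zs} → All Small zs → size zs ℕ.≤ length zs ℕ.* L
    total []       = z≤n
    total (z ∷ zs) = ℕₚ.+-mono-≤ (bits≤ z) (total zs)

  +-time : ∀ {t u} m n → t ℕ.≤ m ℕ.* L → u ℕ.≤ n ℕ.* L → t + u ℕ.≤ (m + n) ℕ.* L
  +-time {t} {u} m n t≤ u≤ =
    subst (t + u ℕ.≤_) (sym (ℕₚ.*-distribʳ-+ L m n)) (ℕₚ.+-mono-≤ t≤ u≤)

  runs-⨾ : ∀ {p q s m n P Q} →
    Runs p s m P → (∀ {s′} → P s′ → Runs q s′ n Q) → Runs (p ⨾ q) s (m + n) Q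
  runs-⨾ {m = m} {n} (runs run₁ t≤ P₁) next with next P₁
  ... | runs run₂ u≤ Q₂ = runs (run₁ ⨾ run₂) (+-time m n t≤ u≤) Q₂

  runs-stop : ∀ {r p s} {Q : State → Set} →
    Small (reg s r) → reg s r ≤ 0ℤ → Q s → Runs (whilePos r loop p) s 1 Q
  runs-stop small ≤0 Qs =
    runs (whileFalse ≤0) (subst (_ ℕ.≤_) (sym (ℕₚ.*-identityˡ L)) (bits≤ small)) Qs

  runs-step : ∀ {r p s m n P Q} → Small (reg s r) → 0ℤ < reg s r →
    Runs p s m P → (∀ {s′} → P s′ → Runs (whilePos r loop p) s′ n Q) →
    Runs (whilePos r loop p) s (suc (m + n)) Q
  runs-step {m = m} {n} small 0< (runs run₁ t≤ P₁) next with next P₁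
  ... | runs run₂ u≤ Q₂ =
    runs (whileTrue 0< run₁ run₂) (ℕₚ.+-mono-≤ (bits≤ small) (+-time m n t≤ u≤)) Q₂

-- Each iteration pays for its body and one test; the final failing test costs one more.
loopCost : ℕ → ℕ → ℕ
loopCost c zero    = 1
loopCost c (suc n) = suc (c + loopCost c n)

loopCost-mono : ∀ c {m n} → m ℕ.≤ n → loopCost c m ℕ.≤ loopCost c n
loopCost-mono c {n = zero}  z≤n       = ℕₚ.≤-refl
loopCost-mono c {n = suc n} z≤n       = s≤s z≤n
loopCost-mono c             (s≤s m≤n) = s≤s (ℕₚ.+-monoʳ-≤ c (loopCost-mono c m≤n))

-- Halving in Euclid's algorithm

gcd-step : ∀ x y → ℕ.gcd x (suc y) ≡ ℕ.gcd (suc y) (x % suc y)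
gcd-step x y = ℕ∣.∣-antisym
  (ℕ.gcd-greatest (ℕ.gcd[m,n]∣n x (suc y))
    (ℕ∣.%-presˡ-∣ (ℕ.gcd[m,n]∣m x (suc y)) (ℕ.gcd[m,n]∣n x (suc y))))
  (ℕ.gcd-greatest {x} {suc y} (ℕ∣.∣n∣m%n⇒∣m {m = x} (ℕ.gcd[m,n]∣m (suc y) (x % suc y)) (ℕ.gcd[m,n]∣n (suc y) (x % suc y)))
    (ℕ.gcd[m,n]∣m (suc y) (x % suc y)))

-- The product of the two current remainders serves as potential. The quotient is at least one, so
-- `x` is at least `suc y` plus the remainder, hence at least twice the remainder.
euclid-halves : ∀ x y → suc y ℕ.≤ x → 2 ℕ.* (suc y ℕ.* (x % suc y)) ℕ.≤ x ℕ.* suc y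
euclid-halves x y y<x = begin
  2 ℕ.* (suc y ℕ.* r)         ≡⟨ shuffle (suc y) r ⟩
  (r + r) ℕ.* suc y           ≤⟨ ℕₚ.*-monoˡ-≤ (suc y) 2r≤x ⟩
  x ℕ.* suc y                 ∎
  where
  open ℕₚ.≤-Reasoning
  r = x % suc y
  shuffle : ∀ u v → 2 ℕ.* (u ℕ.* v) ≡ (v + v) ℕ.* u
  shuffle = ℕ-Ring.solve-∀
  2r≤x : r + r ℕ.≤ x
  2r≤x = begin
    r + r                           ≤⟨ ℕₚ.+-monoʳ-≤ r (ℕᵈ.m%n≤n x (suc y)) ⟩
    r + suc y                       ≡⟨ cong (r ℕ.+_) (ℕₚ.*-identityˡ (suc y)) ⟨
    r + 1 ℕ.* suc y                 ≤⟨ ℕₚ.+-monoʳ-≤ r (ℕₚ.*-monoˡ-≤ (suc y) (ℕᵈ.m≥n⇒m/n>0 y<x)) ⟩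
    r + (x ℕᵈ./ suc y) ℕ.* suc y    ≡⟨ ℕᵈ.m≡m%n+[m/n]*n x (suc y) ⟨
    x                               ∎

-- Magnitudes as powers of `V`

module Bounded (S : ℕ) {{_ : NonZero S}} where

  V : ℕ
  V = 2 ^ S

  -- Being a record rather than a plain inequality, it lets `c` and `z` be inferred from a proof.
  record Fits (c : ℕ) (z : ℤ) : Set where
    constructor fits
    field bound : ∣ z ∣ ℕ.≤ V ^ c

  open Fits public

  -- Bounds the bit length of numbers up to `V ^ 8`: `8 S` digits, one for the successor under the
  -- logarithm, and the sign bit.
  L : ℕ
  L = 2 + S ℕ.* 8

  open Timed L public

  instance
    V≢0 : NonZero V
    V≢0 = ℕₚ.m^n≢0 2 S

  2≤V : 2 ℕ.≤ V
  2≤V = ℕₚ.^-monoʳ-≤ 2 (ℕ.>-nonZero⁻¹ S)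

  1≤V^ : ∀ c → 1 ℕ.≤ V ^ c
  1≤V^ c = ℕₚ.m^n>0 V c

  small : ∀ {c z} {_ : True (c ℕₚ.≤? 8)} → Fits c z → Small z
  small {c} {z} {c≤8} (fits b) = mkSmall (s≤s (begin
    ⌈log₂ suc ∣ z ∣ ⌉        ≤⟨ ⌈log₂⌉-mono-≤ (s≤s (ℕₚ.≤-trans b (ℕₚ.^-monoʳ-≤ V (toWitness c≤8)))) ⟩
    ⌈log₂ suc (V ^ 8) ⌉      ≤⟨ ⌈log₂⌉-mono-≤ (ℕₚ.+-monoˡ-≤ (V ^ 8) (1≤V^ 8)) ⟩
    ⌈log₂ V ^ 8 + V ^ 8 ⌉    ≡⟨ cong (λ w → ⌈log₂ V ^ 8 + w ⌉) (ℕₚ.+-identityʳ (V ^ 8)) ⟨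
    ⌈log₂ 2 ℕ.* V ^ 8 ⌉      ≡⟨ cong (λ w → ⌈log₂ 2 ℕ.* w ⌉) (ℕₚ.^-*-assoc 2 S 8) ⟩
    ⌈log₂ 2 ^ suc (S ℕ.* 8) ⌉ ≡⟨ ⌈log₂2^n⌉≡n (suc (S ℕ.* 8)) ⟩
    suc (S ℕ.* 8)            ∎))
    where open ℕₚ.≤-Reasoning

  fits-0 : Fits 0 0ℤ
  fits-0 = fits z≤n

  fits-1 : Fits 0 1ℤ
  fits-1 = fits ℕₚ.≤-refl

  fits-mono : ∀ {c d z} → c ℕ.≤ d → Fits c z → Fits d z
  fits-mono c≤d (fits b) = fits (ℕₚ.≤-trans b (ℕₚ.^-monoʳ-≤ V c≤d))

  fits-nat : ∀ {n} → n ℕ.≤ V → Fits 1 (+ n)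
  fits-nat n≤V = fits (ℕₚ.≤-trans n≤V (ℕₚ.≤-reflexive (sym (ℕₚ.*-identityʳ V))))

  -- `V` is at least 2, so one further power absorbs the addition.
  sum-fits : ∀ c d {m n} → m ℕ.≤ V ^ c → n ℕ.≤ V ^ d → m + n ℕ.≤ V ^ suc (c ℕ.⊔ d)
  sum-fits c d {m} {n} m≤ n≤ = begin
    m + n              ≤⟨ ℕₚ.+-mono-≤ (ℕₚ.≤-trans m≤ (ℕₚ.^-monoʳ-≤ V (ℕₚ.m≤m⊔n c d)))
                                      (ℕₚ.≤-trans n≤ (ℕₚ.^-monoʳ-≤ V (ℕₚ.m≤n⊔m c d))) ⟩
    W + W              ≡⟨ cong (W ℕ.+_) (ℕₚ.+-identityʳ W) ⟨
    2 ℕ.* W            ≤⟨ ℕₚ.*-monoˡ-≤ W 2≤V ⟩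
    V ℕ.* W            ∎
    where
    open ℕₚ.≤-Reasoning
    W = V ^ (c ℕ.⊔ d)

  fits-- : ∀ {c d x y} → Fits c x → Fits d y → Fits (suc (c ℕ.⊔ d)) (x - y)
  fits-- {c} {d} {x} {y} (fits bx) (fits by) =
    fits (ℕₚ.≤-trans (ℤₚ.∣i-j∣≤∣i∣+∣j∣ x y) (sum-fits c d bx by))

  fits-* : ∀ {c d x y} → Fits c x → Fits d y → Fits (c + d) (x * y)
  fits-* {c} {d} {x} {y} (fits bx) (fits by) = fits (begin
    ∣ x * y ∣          ≡⟨ ℤₚ.abs-* x y ⟩
    ∣ x ∣ ℕ.* ∣ y ∣    ≤⟨ ℕₚ.*-mono-≤ bx by ⟩
    V ^ c ℕ.* V ^ d    ≡⟨ ℕₚ.^-distribˡ-+-* V c d ⟨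
    V ^ (c + d)        ∎)
    where open ℕₚ.≤-Reasoning

  fits-÷ : ∀ {c x y} → Fits c x → Fits c (x ÷ y)
  fits-÷ {x = x} {y} (fits b) = fits (ℕₚ.≤-trans (∣÷∣≤ x y) b)

-- The extended Euclidean algorithm

-- A frame condition; writing registers as `r + k` makes each instance at a numeral evaluate to a
-- concrete register.
Unchanged≥ : Reg → State → State → Set
Unchanged≥ r s s′ = ∀ k → reg s′ (r + k) ≡ reg s (r + k)

-- Registers: 0, 1 scratch; 2, 3 remainders and 4, 5 their cofactors; 6 the modulus f (j - 1);
-- 7 the coefficient a j; 8 the index j; 9 the inner counter; 10 the index i; 11 the residue β;
-- 12 the constant 0; 13 the constant 1; 14 the number of coefficients.
euclidBody euclidLoop : Program
euclidBody =
  arith div 0 2 3 ⨾ arith mul 1 0 3 ⨾ arith sub 1 2 1 ⨾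
  -- Adding register 12, which holds zero, copies a register: the remainders move one place along.
  arith add 2 3 12 ⨾ arith add 3 1 12 ⨾
  arith mul 1 0 5 ⨾ arith sub 1 4 1 ⨾ arith add 4 5 12 ⨾
  arith div 0 1 6 ⨾ arith mul 0 0 6 ⨾ arith sub 5 1 0
euclidLoop = whilePos 3 loop euclidBody

+-zero : ∀ {x z} → z ≡ 0ℤ → x ℤ.+ z ≡ x
+-zero {x} refl = ℤₚ.+-identityʳ x

rem-≡ : ∀ i {j k} → j ≡ +[1+ k ] → i - (i ÷ j) * j ≡ + (i %ℕ suc k)
rem-≡ i {k = k} refl = ÷-rem i k

module Euclid (S : ℕ) {{_ : NonZero S}} (α : ℤ) (μ : ℕ) (μ<V : suc μ ℕ.≤ 2 ^ S) where

  open Bounded S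

  -- The congruence of `x` and `v α` modulo `m`. The program stores only `v`; the witness `c` lives
  -- in the proof and needs no size bound.
  Bezout : ℤ → ℤ → ℤ → Set
  Bezout x v m = ∃[ c ] x ≡ v * α ℤ.+ c * m

  record Inv (x y : ℕ) (s : State) : Set where
    field
      r₀   : reg s 2 ≡ + x
      r₁   : reg s 3 ≡ + y
      y≤x  : y ℕ.≤ x
      x≤V  : x ℕ.≤ V
      v₀   : Fits 1 (reg s 4)
      v₁   : Fits 1 (reg s 5)
      bez₀ : Bezout (reg s 2) (reg s 4) (reg s 6)
      bez₁ : Bezout (reg s 3) (reg s 5) (reg s 6)
      m    : reg s 6 ≡ +[1+ μ ]
      z    : reg s 12 ≡ 0ℤ

  record Post (g : ℕ) (s s′ : State) : Set where
    field
      gcd≡   : reg s′ 2 ≡ + g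
      cofits : Fits 1 (reg s′ 4)
      bezout : Bezout (reg s′ 2) (reg s′ 4) (reg s′ 6)
      regs   : Unchanged≥ 6 s s′
      mems   : mem s′ ≡ mem s

  step-inv : ∀ {x y s} → Inv x (suc y) s → Inv (suc y) (x % suc y) (exec euclidBody s)
  step-inv {x} {y} {s} I = record
    { r₀   = trans (+-zero z) r₁
    ; r₁   = trans (+-zero z) (trans (rem-≡ (reg s 2) r₁) (cong (λ i → + (i %ℕ suc y)) r₀))
    ; y≤x  = ℕᵈ.m%n≤n x (suc y)
    ; x≤V  = ℕₚ.≤-trans y≤x x≤V
    ; v₀   = subst (Fits 1) (sym (+-zero z)) v₁
    ; v₁   = subst (Fits 1) (sym (rem-≡ t m))
        (fits-nat (ℕₚ.≤-trans (ℕₚ.<⇒≤ (ℤᵈ.n%ℕd<d t (suc μ))) μ<V))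
    ; bez₀ = proj₁ bez₁ , trans (+-zero z) (trans (proj₂ bez₁)
        (cong (λ v → v * α ℤ.+ proj₁ bez₁ * reg s 6) (sym (+-zero {reg s 5} z))))
    -- The Euclidean step gives `c₀ - q c₁`; subtracting `w` moduli from the new cofactor adds `w α`
    -- here.
    ; bez₁ = proj₁ bez₀ - q * proj₁ bez₁ ℤ.+ (t ÷ reg s 6) * α , trans (+-zero z) (trans
        (cong₂ (λ X Y → X - q * Y) (proj₂ bez₀) (proj₂ bez₁))
        (combine (reg s 4) (reg s 5) α (proj₁ bez₀) (proj₁ bez₁) (reg s 6) q (t ÷ reg s 6)))
    ; m    = m
    ; z    = z
    }
    where
    open Inv I
    q t : ℤ
    q = reg s 2 ÷ reg s 3
    t = reg s 4 - q * reg s 5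
    combine : ∀ v₀ v₁ α c₀ c₁ m q w → (v₀ * α ℤ.+ c₀ * m) - q * (v₁ * α ℤ.+ c₁ * m)
      ≡ (v₀ - q * v₁ - w * m) * α ℤ.+ (c₀ - q * c₁ ℤ.+ w * α) * m
    combine = solve-∀

  -- The reduced cofactors enter with exponent 1, so no exponent here exceeds 4.
  step-small : ∀ {x y s} → Inv x y s → All Small (operands euclidBody s)
  step-small {x} {y} {s} I =
    small f₂ ∷ small f₃ ∷
    small fq ∷ small f₃ ∷
    small f₂ ∷ small fqr ∷
    small f₃ ∷ small f₁₂ ∷
    small fr ∷ small f₁₂ ∷
    small fq ∷ small v₁ ∷
    small v₀ ∷ small fqv ∷
    small v₁ ∷ small f₁₂ ∷
    small ft ∷ small f₆ ∷
    small fw ∷ small f₆ ∷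
    small ft ∷ small fwm ∷ []
    where
    open Inv I
    f₂  = subst (Fits 1) (sym r₀) (fits-nat x≤V)
    f₃  = subst (Fits 1) (sym r₁) (fits-nat (ℕₚ.≤-trans y≤x x≤V))
    f₆  = subst (Fits 1) (sym m) (fits-nat μ<V)
    f₁₂ = subst (Fits 0) (sym z) fits-0
    fq  = fits-÷ {y = reg s 3} f₂
    fqr = fits-* fq f₃
    fr  = fits-- f₂ fqr
    fqv = fits-* fq v₁
    ft  = fits-- v₀ fqv
    fw  = fits-÷ {y = reg s 6} ft
    fwm = fits-* fw f₆

  -- Induction on a power of two exceeding the product of the remainders; each pass halves the
  -- product, so `n` bounds the number of passes.
  euclid : ∀ n {x y s} → Inv x y s → x ℕ.* y ℕ.< 2 ^ n →
    Runs euclidLoop s (loopCost 22 n) (Post (ℕ.gcd x y) s)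
  euclid n {x} {zero} {s} I _ = runs-⇒ (loopCost-mono 22 (z≤n {n})) (λ p → p)
    (runs-stop (small (subst (Fits 0) (sym r₁) fits-0)) (ℤₚ.≤-reflexive r₁) record
      { gcd≡   = trans r₀ (cong +_ (sym (ℕ.gcd-identityʳ x)))
      ; cofits = v₀
      ; bezout = bez₀
      ; regs   = λ _ → refl
      ; mems   = refl
      })
    where open Inv I
  -- A product below 1 with a positive second remainder makes the first zero, which `y≤x` forbids.
  euclid zero {suc x} {suc y} I (s≤s ())
  euclid zero {zero} {suc y} record { y≤x = () } _
  euclid (suc n) {x} {suc y} {s} I x*y< =
    runs-step (small (subst (Fits 1) (sym r₁) (fits-nat (ℕₚ.≤-trans y≤x x≤V))))
      (subst (0ℤ <_) (sym r₁) (+<+ (s≤s z≤n)))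
      (runs-straight euclidBody (step-small I))
      λ { refl → runs-⇒ ℕₚ.≤-refl after (euclid n (step-inv I) halved) }
    where
    open Inv I
    halved : suc y ℕ.* (x % suc y) ℕ.< 2 ^ n
    halved = ℕₚ.*-cancelˡ-< 2 _ _ (ℕₚ.≤-<-trans (euclid-halves x y y≤x) x*y<)
    after : ∀ {s′} → Post (ℕ.gcd (suc y) (x % suc y)) (exec euclidBody s) s′ → Post (ℕ.gcd x (suc y)) s s′
    after P = record
      { gcd≡   = trans (Post.gcd≡ P) (cong +_ (sym (gcd-step x y)))
      ; cofits = Post.cofits P
      ; bezout = Post.bezout P
      ; regs   = Post.regs P
      ; mems   = Post.mems P
      }

-- The solver program

-- One pass adds one coefficient to the prefix gcd. Euclid starts from the old gcd and the
-- coefficient reduced modulo it, with cofactors 0 and 1.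
innerPre innerPost innerLoop : Program
innerPre =
  arith add 6 2 12 ⨾ load 7 8 ⨾ arith div 0 7 6 ⨾ arith mul 1 0 6 ⨾ arith sub 3 7 1 ⨾
  const 4 0ℤ ⨾ const 5 1ℤ
innerPost = arith add 8 8 13 ⨾ arith sub 9 9 13
innerLoop = whilePos 9 loop (innerPre ⨾ (euclidLoop ⨾ innerPost))

-- The inner loop restarts from the first coefficient; its last pass leaves `f i`, a cofactor,
-- `f (i - 1)` and the coefficient in registers 2, 4, 6 and 7. The new coordinate then overwrites
-- that coefficient.
outerPre outerPost outerLoop : Program
outerPre = load 2 12 ⨾ arith add 8 13 12 ⨾ arith add 9 10 12
outerPost =
  -- Register 0 becomes `(β / f i) v` and register 1 the quotient `f (i - 1) / f i`, modulo which it
  -- is reduced next.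
  arith div 0 11 2 ⨾ arith mul 0 0 4 ⨾ arith div 1 6 2 ⨾
  arith div 3 0 1 ⨾ arith mul 3 3 1 ⨾ arith sub 0 0 3 ⨾
  arith mul 1 7 0 ⨾ arith sub 11 11 1 ⨾ store 10 0 ⨾ arith sub 10 10 13
outerLoop = whilePos 10 loop (outerPre ⨾ (innerLoop ⨾ outerPost))

solverPre solverPost solver : Program
-- Register 0 counts the coefficients and `b`. One less is both the number of coefficients and the
-- address of `b`; two less is the last coefficient's index.
solverPre = const 13 1ℤ ⨾ arith sub 14 0 13 ⨾ load 11 14 ⨾ arith sub 10 14 13
solverPost = load 2 12 ⨾ arith div 0 11 2 ⨾ store 12 0 ⨾ arith add 0 14 12
solver = solverPre ⨾ (outerLoop ⨾ solverPost)

-- Prefix gcds, memory updates and sums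

-- Nested to the left, in the order in which the inner loop meets the coefficients.
prefixGcdℕ : (ℕ → ℕ) → ℕ → ℕ
prefixGcdℕ a zero    = a 0
prefixGcdℕ a (suc j) = ℕ.gcd (prefixGcdℕ a j) (a (suc j))

update-same : ∀ (f : ℕ → ℤ) k {v} → (f [ k ↦ v ]) k ≡ v
update-same f k with k ℕ.≡ᵇ k | ℕₚ.≡⇒≡ᵇ k k refl
... | true | _ = refl

update-other : ∀ (f : ℕ → ℤ) k {v j} → k ≢ j → (f [ k ↦ v ]) j ≡ f j
update-other f k {j = j} k≢j with j ℕ.≡ᵇ k | ℕₚ.≡ᵇ⇒≡ j k
... | false | _   = refl
... | true  | j≡k = contradiction (sym (j≡k tt)) k≢j

-- `sumℤ` unfolds at its head, whereas induction over the outer loop adds the term of highest index.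
sumℤ-last : ∀ n (g : ℕ → ℤ) → sumℤ {suc n} (g ∘ toℕ) ≡ sumℤ {n} (g ∘ toℕ) ℤ.+ g n
sumℤ-last n g = trans (sum-init-last ℤₚ.+-0-monoid {n} (g ∘ toℕ))
  (cong₂ ℤ._+_ (sum-cong-≗ ℤₚ.+-0-monoid {n} (λ i → cong g (toℕ-inject₁ i))) (cong g (toℕ-fromℕ n)))

-- Correctness of the inner loop

module Solve (S : ℕ) {{_ : NonZero S}} (a : ℕ → ℕ)
             (a≤V : ∀ j → a j ℕ.≤ 2 ^ S) (a₀>0 : 0 ℕ.< a 0) where

  open Bounded S

  f : ℕ → ℕ
  f = prefixGcdℕ a

  f>0 : ∀ j → 0 ℕ.< f j
  f>0 zero    = a₀>0
  f>0 (suc j) = ℕₚ.n≢0⇒n>0 (ℕ.gcd[m,n]≢0 (f j) (a (suc j)) (inj₁ (ℕₚ.m<n⇒n≢0 (f>0 j))))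

  f≤V : ∀ j → f j ℕ.≤ V
  f≤V zero    = a≤V 0
  f≤V (suc j) = ℕₚ.≤-trans
    (ℕ∣.∣⇒≤ {{ℕ.>-nonZero (f>0 j)}} (ℕ.gcd[m,n]∣m (f j) (a (suc j)))) (f≤V j)

  f-view : ∀ j → ∃[ μ ] f j ≡ suc μ
  f-view j with f j | f>0 j
  ... | suc μ | _ = μ , refl

  -- i + 1 is the index of the last coefficient of the prefix.
  record InnerInv (i j k : ℕ) (s : State) : Set where
    field
      g     : reg s 2 ≡ + f j
      index : reg s 8 ≡ + suc j
      count : reg s 9 ≡ + k
      z₀    : reg s 12 ≡ 0ℤ
      one   : reg s 13 ≡ 1ℤ
      coeffs : ∀ l → l ℕ.≤ suc i → mem s l ≡ + a l
      range : j + k ≡ suc i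
      i<V   : suc i ℕ.≤ V

  record InnerPost (j : ℕ) (s s′ : State) : Set where
    field
      prev   : reg s′ 6 ≡ + f j
      coeff  : reg s′ 7 ≡ + a (suc j)
      g      : reg s′ 2 ≡ + f (suc j)
      cofits : Fits 1 (reg s′ 4)
      bezout : ∃[ c ] reg s′ 2 ≡ reg s′ 4 * + a (suc j) ℤ.+ c * reg s′ 6
      regs   : Unchanged≥ 10 s s′
      mems   : mem s′ ≡ mem s

  -- The starting remainders have product at most `V * V`, which is below `2 ^ (2 S + 1)`. The
  -- numbers 12, 22 and 4 count the operands of `innerPre`, `euclidBody` and `innerPost`.
  euclidFuel euclidCost innerCost : ℕ
  euclidFuel = suc (S + S)
  euclidCost = loopCost 22 euclidFuel
  innerCost  = 12 + (euclidCost + 4)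

  module InnerBody {i j k s} (I : InnerInv i j (suc k) s) where
    open InnerInv I

    μ : ℕ
    μ = proj₁ (f-view j)

    f≡ : f j ≡ suc μ
    f≡ = proj₂ (f-view j)

    μ<V : suc μ ℕ.≤ V
    μ<V = subst (ℕ._≤ V) f≡ (f≤V j)

    open Euclid S (+ a (suc j)) μ μ<V

    j≤i : j ℕ.≤ i
    j≤i = ℕₚ.≤-pred (subst (suc j ℕ.≤_) range
      (subst (suc j ℕ.≤_) (sym (ℕₚ.+-suc j k)) (s≤s (ℕₚ.m≤m+n j k))))

    cell : mem s ∣ reg s 8 ∣ ≡ + a (suc j)
    cell = trans (cong (mem s ∘ ∣_∣) index) (coeffs (suc j) (s≤s j≤i))

    m : reg s 2 ℤ.+ reg s 12 ≡ +[1+ μ ]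
    m = trans (+-zero z₀) (trans g (cong +_ f≡))

    r : ℕ
    r = a (suc j) % suc μ

    r≤f : r ℕ.≤ f j
    r≤f = subst (r ℕ.≤_) (sym f≡) (ℕᵈ.m%n≤n (a (suc j)) (suc μ))

    s₁ : State
    s₁ = exec innerPre s

    start : Inv (f j) r s₁
    start = record
      { r₀   = g
      ; r₁   = trans (rem-≡ (mem s ∣ reg s 8 ∣) m) (cong (λ z → + (z %ℕ suc μ)) cell)
      ; y≤x  = r≤f
      ; x≤V  = f≤V j
      ; v₀   = fits-mono z≤n fits-0
      ; v₁   = fits-mono z≤n fits-1
      -- The modulus is zero times the coefficient plus once itself; the reduced coefficient is the
      -- coefficient minus `w` moduli.
      ; bez₀ = 1ℤ , trans (unit (reg s 2) (+ a (suc j)))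
          (cong (λ x → 0ℤ * + a (suc j) ℤ.+ 1ℤ * x) (sym (+-zero {reg s 2} z₀)))
      ; bez₁ = ℤ.- w , trans (cong (ℤ._- w * (reg s 2 ℤ.+ reg s 12)) cell)
          (reduce (+ a (suc j)) w (reg s 2 ℤ.+ reg s 12))
      ; m    = m
      ; z    = z₀
      }
      where
      w : ℤ
      w = mem s ∣ reg s 8 ∣ ÷ (reg s 2 ℤ.+ reg s 12)
      unit : ∀ x y → x ≡ 0ℤ * y ℤ.+ 1ℤ * x
      unit = solve-∀
      reduce : ∀ x w m → x - w * m ≡ 1ℤ * x ℤ.+ (ℤ.- w) * m
      reduce = solve-∀

    pre-small : All Small (operands innerPre s)
    pre-small =
      small f₂ ∷ small f₁₂ ∷
      small f₈ ∷ small fa ∷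
      small fa ∷ small fm ∷
      small fw ∷ small fm ∷
      small fa ∷ small fwm ∷
      small fits-0 ∷ small fits-1 ∷ []
      where
      f₂  = subst (Fits 1) (sym g) (fits-nat (f≤V j))
      f₁₂ = subst (Fits 0) (sym z₀) fits-0
      f₈  = subst (Fits 1) (sym index) (fits-nat (ℕₚ.≤-trans (s≤s j≤i) i<V))
      fa  = subst (Fits 1) (sym cell) (fits-nat (a≤V (suc j)))
      fm  = subst (Fits 1) (sym m) (fits-nat μ<V)
      fw  = fits-÷ {y = reg s 2 ℤ.+ reg s 12} fa
      fwm = fits-* fw fm

    fuel : f j ℕ.* r ℕ.< 2 ^ euclidFuel
    fuel = begin-strict
      f j ℕ.* r      ≤⟨ ℕₚ.*-mono-≤ (f≤V j) (ℕₚ.≤-trans r≤f (f≤V j)) ⟩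
      V ℕ.* V        ≡⟨ ℕₚ.^-distribˡ-+-* 2 S S ⟨
      2 ^ (S + S)    <⟨ ℕₚ.^-monoʳ-< 2 (s≤s (s≤s z≤n)) (ℕₚ.n<1+n (S + S)) ⟩
      2 ^ euclidFuel ∎
      where open ℕₚ.≤-Reasoning

    gcd≡f : ℕ.gcd (f j) r ≡ f (suc j)
    gcd≡f = begin
      ℕ.gcd (f j) r              ≡⟨ cong (λ x → ℕ.gcd x r) f≡ ⟩
      ℕ.gcd (suc μ) r            ≡⟨ gcd-step (a (suc j)) μ ⟨
      ℕ.gcd (a (suc j)) (suc μ)  ≡⟨ ℕ.gcd-comm (a (suc j)) (suc μ) ⟩
      ℕ.gcd (suc μ) (a (suc j))  ≡⟨ cong (λ x → ℕ.gcd x (a (suc j))) f≡ ⟨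
      f (suc j)                  ∎
      where open ≡-Reasoning

    module _ {s₂} (P : Post (ℕ.gcd (f j) r) s₁ s₂) where
      open Post P renaming (regs to regs₂; mems to mems₂; cofits to cofits₂; bezout to bezout₂)

      one₂ : reg s₂ 13 ≡ 1ℤ
      one₂ = trans (regs₂ 7) one

      index₂ : reg s₂ 8 ≡ + suc j
      index₂ = trans (regs₂ 2) index

      count₂ : reg s₂ 9 ≡ + suc k
      count₂ = trans (regs₂ 3) count

      post-small : All Small (operands innerPost s₂)
      post-small = small f₈ ∷ small f₁₃ ∷ small f₉ ∷ small f₁₃ ∷ []
        where
        f₈  = subst (Fits 1) (sym index₂) (fits-nat (ℕₚ.≤-trans (s≤s j≤i) i<V))
        f₉  = subst (Fits 1) (sym count₂)
          (fits-nat (ℕₚ.≤-trans (ℕₚ.m≤n+m (suc k) j) (ℕₚ.≤-trans (ℕₚ.≤-reflexive range) i<V)))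
        f₁₃ = subst (Fits 0) (sym one₂) fits-1

      finished : InnerPost j s (exec innerPost s₂) × InnerInv i (suc j) k (exec innerPost s₂)
      finished = record
        { prev   = trans (regs₂ 0) (trans (+-zero z₀) g)
        ; coeff  = trans (regs₂ 1) cell
        ; g      = g₂
        ; cofits = cofits₂
        ; bezout = bezout₂
        ; regs   = λ l → regs₂ (4 + l)
        ; mems   = mems₂
        } , record
        { g     = g₂
        ; index = trans (cong₂ ℤ._+_ index₂ one₂) (cong +_ (ℕₚ.+-comm (suc j) 1))
        ; count = cong₂ _-_ count₂ one₂
        ; z₀    = trans (regs₂ 6) z₀
        ; one   = one₂
        ; coeffs = λ l l≤ → trans (cong (λ M → M l) mems₂) (coeffs l l≤)
        ; range = trans (sym (ℕₚ.+-suc j k)) range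
        ; i<V   = i<V
        }
        where
        g₂ : reg s₂ 2 ≡ + f (suc j)
        g₂ = trans gcd≡ (cong +_ gcd≡f)

    body-runs : Runs (innerPre ⨾ (euclidLoop ⨾ innerPost)) s innerCost
      (λ s′ → InnerPost j s s′ × InnerInv i (suc j) k s′)
    body-runs = runs-⨾ (runs-straight innerPre pre-small)
      λ { refl → runs-⨾ (euclid euclidFuel start fuel)
      λ P → runs-⇒ ℕₚ.≤-refl (λ { refl → finished P }) (runs-straight innerPost (post-small P)) }

  -- Stated for at least one remaining pass, because the postcondition describes the last pass made.
  inner-runs : ∀ k {i j s} → InnerInv i j (suc k) s →
    Runs innerLoop s (loopCost innerCost (suc k)) (InnerPost i s)
  inner-runs k {i} {j} {s} I = runs-step
    (small (subst (Fits 1) (sym count)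
      (fits-nat (ℕₚ.≤-trans (ℕₚ.m≤n+m (suc k) j) (ℕₚ.≤-trans (ℕₚ.≤-reflexive range) i<V)))))
    (subst (0ℤ <_) (sym count) (+<+ (s≤s z≤n)))
    (InnerBody.body-runs I)
    (λ (P , I′) → rest k range P I′)
    where
    open InnerInv I
    rest : ∀ k → j + suc k ≡ suc i → ∀ {s′} → InnerPost j s s′ → InnerInv i (suc j) k s′ →
      Runs innerLoop s′ (loopCost innerCost k) (InnerPost i s)
    -- With no pass left, `j` equals `i`, so the postcondition of this pass is that of the loop.
    rest zero e {s′} P I′ = runs-stop (small (subst (Fits 0) (sym count′) fits-0)) (ℤₚ.≤-reflexive count′)
      (subst (λ j → InnerPost j s s′) (ℕₚ.suc-injective (trans (ℕₚ.+-comm 1 j) e)) P)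
      where count′ = InnerInv.count I′
    rest (suc k) _ P I′ = runs-⇒ ℕₚ.≤-refl (λ P′ → record
      { prev   = InnerPost.prev P′
      ; coeff  = InnerPost.coeff P′
      ; g      = InnerPost.g P′
      ; cofits = InnerPost.cofits P′
      ; bezout = InnerPost.bezout P′
      ; regs   = λ l → trans (InnerPost.regs P′ l) (InnerPost.regs P l)
      ; mems   = trans (InnerPost.mems P′) (InnerPost.mems P)
      }) (inner-runs k I′)

  -- Correctness of the outer loop

  -- Only coefficients up to `i` are claimed, since coordinates have replaced the later ones.
  -- Divisibility by `f i` keeps the remaining equation solvable over the integers.
  record OuterInv (i : ℕ) (s : State) : Set where
    field
      coeffs  : ∀ l → l ℕ.≤ i → mem s l ≡ + a l
      count   : reg s 10 ≡ + i
      z₀      : reg s 12 ≡ 0ℤ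
      one     : reg s 13 ≡ 1ℤ
      residue : ∃[ γ ] reg s 11 ≡ γ * + f i
      -- Each remaining index changes the residue by at most V ².
      budget  : ∣ reg s 11 ∣ + i ℕ.* (V ℕ.* V) ℕ.≤ V ^ 4
      i≤V     : i ℕ.≤ V

  -- A complete residue system modulo `f j / f (j + 1)`; its upper end produces the terms of `G`.
  InRange : ℕ → ℤ → Set
  InRange j x = 0ℤ ≤ x × x < + f j ÷ + f (suc j)

  record OuterStep (i : ℕ) (s s′ : State) : Set where
    field
      next  : OuterInv i s′
      regs  : Unchanged≥ 12 s s′
      other : ∀ l → suc i ≢ l → mem s′ l ≡ mem s l
      coord : InRange i (mem s′ (suc i))
      total : + a (suc i) * mem s′ (suc i) ℤ.+ reg s′ 11 ≡ reg s 11

  module OuterBody {i s} (I : OuterInv (suc i) s) where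
    open OuterInv I

    s₁ : State
    s₁ = exec outerPre s

    f₁₁ : Fits 4 (reg s 11)
    f₁₁ = fits (ℕₚ.≤-trans (ℕₚ.m≤m+n ∣ reg s 11 ∣ _) budget)

    first : mem s ∣ reg s 12 ∣ ≡ + a 0
    first = trans (cong (mem s ∘ ∣_∣) z₀) (coeffs 0 z≤n)

    pre-small : All Small (operands outerPre s)
    pre-small =
      small f₁₂ ∷ small (subst (Fits 1) (sym first) (fits-nat (a≤V 0))) ∷
      small (subst (Fits 0) (sym one) fits-1) ∷ small f₁₂ ∷
      small (subst (Fits 1) (sym count) (fits-nat i≤V)) ∷ small f₁₂ ∷ []
      where f₁₂ = subst (Fits 0) (sym z₀) fits-0

    start : InnerInv i 0 (suc i) s₁
    start = record
      { g      = first
      ; index  = trans (+-zero z₀) one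
      ; count  = trans (+-zero z₀) count
      ; z₀     = z₀
      ; one    = one
      ; coeffs = coeffs
      ; range  = refl
      ; i<V    = i≤V
      }

    module _ {s₂} (P : InnerPost i s₁ s₂) where
      open InnerPost P renaming (regs to regs₂)

      β₂ : reg s₂ 11 ≡ reg s 11
      β₂ = regs₂ 1

      count₂ : reg s₂ 10 ≡ + suc i
      count₂ = trans (regs₂ 0) count

      one₂ : reg s₂ 13 ≡ 1ℤ
      one₂ = trans (regs₂ 3) one

      q d x β′ : ℤ
      q = reg s₂ 11 ÷ reg s₂ 2
      d = reg s₂ 6 ÷ reg s₂ 2
      x = q * reg s₂ 4 - (q * reg s₂ 4 ÷ d) * d
      β′ = reg s₂ 11 - reg s₂ 7 * x

      γ : ℤ
      γ = proj₁ residue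

      f∣f : f (suc i) ℕ∣.∣ f i
      f∣f = ℕ.gcd[m,n]∣m (f i) (a (suc i))

      f∣a : f (suc i) ℕ∣.∣ a (suc i)
      f∣a = ℕ.gcd[m,n]∣n (f i) (a (suc i))

      t : ℕ
      t = ℕ∣.quotient f∣f

      f≡ : + f i ≡ + t * + f (suc i)
      f≡ = trans (cong +_ (ℕ∣._∣_.equality f∣f)) (ℤₚ.pos-* t (f (suc i)))

      a≡ : + a (suc i) ≡ + ℕ∣.quotient f∣a * + f (suc i)
      a≡ = trans (cong +_ (ℕ∣._∣_.equality f∣a)) (ℤₚ.pos-* (ℕ∣.quotient f∣a) (f (suc i)))

      f÷f≡ : + f i ÷ + f (suc i) ≡ + t
      f÷f≡ = trans (cong (_÷ + f (suc i)) f≡) (÷-cancel (+ t) (f>0 (suc i)))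

      d≡f÷f : d ≡ + f i ÷ + f (suc i)
      d≡f÷f = cong₂ _÷_ prev g

      t-view : ∃[ k ] t ≡ suc k
      t-view with t | ℕ∣._∣_.equality f∣f
      ... | zero  | e = contradiction e (ℕₚ.m<n⇒n≢0 (f>0 i))
      ... | suc k | _ = k , refl

      k : ℕ
      k = proj₁ t-view

      d≡ : d ≡ +[1+ k ]
      d≡ = trans d≡f÷f (trans f÷f≡ (cong +_ (proj₂ t-view)))

      q≡γ : q ≡ γ
      q≡γ = trans (cong₂ _÷_ (trans β₂ (proj₂ residue)) g) (÷-cancel γ (f>0 (suc i)))

      x≡ : x ≡ + ((q * reg s₂ 4) %ℕ suc k)
      x≡ = rem-≡ (q * reg s₂ 4) d≡

      x-range : InRange i x
      x-range = subst (0ℤ ≤_) (sym x≡) (+≤+ z≤n)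
        , subst₂ _<_ (sym x≡) (trans (sym d≡) d≡f÷f) (+<+ (ℤᵈ.n%ℕd<d (q * reg s₂ 4) (suc k)))

      x-fits : Fits 1 x
      x-fits = subst (Fits 1) (sym x≡) (fits-nat (begin
        (q * reg s₂ 4) %ℕ suc k  ≤⟨ ℕₚ.<⇒≤ (ℤᵈ.n%ℕd<d (q * reg s₂ 4) (suc k)) ⟩
        suc k                    ≡⟨ proj₂ t-view ⟨
        t                        ≤⟨ ℕₚ.m≤m*n t (f (suc i)) {{ℕ.>-nonZero (f>0 (suc i))}} ⟩
        t ℕ.* f (suc i)          ≡⟨ ℕ∣._∣_.equality f∣f ⟨
        f i                      ≤⟨ f≤V i ⟩
        V                        ∎))
        where open ℕₚ.≤-Reasoning

      -- With g = v a + c m, m = d g and a = a′ g, subtracting a x for x = γ v - w d from β = γ g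
      -- leaves (γ c + a′ w) m.
      residue′ : ∃[ γ′ ] β′ ≡ γ′ * + f i
      residue′ = γ * c ℤ.+ w * a′ , (begin
        reg s₂ 11 - reg s₂ 7 * x
          ≡⟨ cong₂ (λ β α → β - α * x) β≡ coeff ⟩
        γ * (v * α ℤ.+ c * + f i) - α * (q * v - w * d)
          ≡⟨ cong₂ (λ q d → γ * (v * α ℤ.+ c * + f i) - α * (q * v - w * d)) q≡γ (trans d≡f÷f f÷f≡) ⟩
        γ * (v * α ℤ.+ c * + f i) - α * (γ * v - w * + t)
          ≡⟨ expand γ v α c (+ f i) w (+ t) ⟩
        γ * c * + f i ℤ.+ w * (α * + t)
          ≡⟨ cong (λ z → γ * c * + f i ℤ.+ w * z) swap ⟩
        γ * c * + f i ℤ.+ w * (a′ * + f i)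
          ≡⟨ collect (γ * c) (+ f i) w a′ ⟩
        (γ * c ℤ.+ w * a′) * + f i ∎)
        where
        open ≡-Reasoning
        v c w α a′ : ℤ
        v  = reg s₂ 4
        c  = proj₁ bezout
        w  = q * v ÷ d
        α  = + a (suc i)
        a′ = + ℕ∣.quotient f∣a
        β≡ : reg s₂ 11 ≡ γ * (v * α ℤ.+ c * + f i)
        β≡ = trans β₂ (trans (proj₂ residue) (cong (γ *_)
          (trans (sym g) (trans (proj₂ bezout) (cong (λ m → v * α ℤ.+ c * m) prev)))))
        expand : ∀ γ v α c m w d → γ * (v * α ℤ.+ c * m) - α * (γ * v - w * d) ≡ γ * c * m ℤ.+ w * (α * d)
        expand = solve-∀
        rotate : ∀ x y z → x * y * z ≡ x * (z * y)
        rotate = solve-∀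
        collect : ∀ x m w a → x * m ℤ.+ w * (a * m) ≡ (x ℤ.+ w * a) * m
        collect = solve-∀
        -- Both sides are `a′ t f (i + 1)`, written with the index `i` of this pass.
        swap : α * + t ≡ a′ * + f i
        swap = trans (cong (_* + t) a≡)
          (trans (rotate a′ (+ f (suc i)) (+ t)) (cong (a′ *_) (sym f≡)))

      budget′ : ∣ β′ ∣ + i ℕ.* (V ℕ.* V) ℕ.≤ V ^ 4
      budget′ = begin
        ∣ β′ ∣ + i ℕ.* (V ℕ.* V)
          ≤⟨ ℕₚ.+-monoˡ-≤ _ (ℤₚ.∣i-j∣≤∣i∣+∣j∣ (reg s₂ 11) (reg s₂ 7 * x)) ⟩
        ∣ reg s₂ 11 ∣ + ∣ reg s₂ 7 * x ∣ + i ℕ.* (V ℕ.* V)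
          ≤⟨ ℕₚ.+-monoˡ-≤ _ (ℕₚ.+-mono-≤ (ℕₚ.≤-reflexive (cong ∣_∣ β₂)) ax≤) ⟩
        ∣ reg s 11 ∣ + V ℕ.* V + i ℕ.* (V ℕ.* V)
          ≡⟨ ℕₚ.+-assoc ∣ reg s 11 ∣ (V ℕ.* V) _ ⟩
        ∣ reg s 11 ∣ + suc i ℕ.* (V ℕ.* V)
          ≤⟨ budget ⟩
        V ^ 4 ∎
        where
        open ℕₚ.≤-Reasoning
        ax≤ : ∣ reg s₂ 7 * x ∣ ℕ.≤ V ℕ.* V
        ax≤ = begin
          ∣ reg s₂ 7 * x ∣           ≡⟨ ℤₚ.abs-* (reg s₂ 7) x ⟩
          ∣ reg s₂ 7 ∣ ℕ.* ∣ x ∣     ≤⟨ ℕₚ.*-mono-≤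
            (ℕₚ.≤-trans (ℕₚ.≤-reflexive (cong ∣_∣ coeff)) (a≤V (suc i)))
            (ℕₚ.≤-trans (Fits.bound x-fits) (ℕₚ.≤-reflexive (ℕₚ.*-identityʳ V))) ⟩
          V ℕ.* V                    ∎

      -- The residue has exponent 4 and the cofactor 1, so exponents reach at most 6, in `fwd`.
      post-small : All Small (operands outerPost s₂)
      post-small =
        small fβ ∷ small f₂ ∷
        small fq ∷ small cofits ∷
        small f₆ ∷ small f₂ ∷
        small fqv ∷ small fd ∷
        small fw ∷ small fd ∷
        small fqv ∷ small fwd ∷
        small f₇ ∷ small x-fits ∷
        small fβ ∷ small fax ∷
        small f₁₀ ∷ small x-fits ∷
        small f₁₀ ∷ small (subst (Fits 0) (sym one₂) fits-1) ∷ []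
        where
        fβ  = subst (Fits 4) (sym β₂) f₁₁
        f₂  = subst (Fits 1) (sym g) (fits-nat (f≤V (suc i)))
        f₆  = subst (Fits 1) (sym prev) (fits-nat (f≤V i))
        f₇  = subst (Fits 1) (sym coeff) (fits-nat (a≤V (suc i)))
        f₁₀ = subst (Fits 1) (sym count₂) (fits-nat i≤V)
        fq  = fits-÷ {y = reg s₂ 2} fβ
        fqv = fits-* fq cofits
        fd  = fits-÷ {y = reg s₂ 2} f₆
        fw  = fits-÷ {y = d} fqv
        fwd = fits-* fw fd
        fax = fits-* f₇ x-fits

      s₃ : State
      s₃ = exec outerPost s₂

      at : ∀ l → mem s₃ l ≡ (mem s [ suc i ↦ x ]) l
      at l = cong₂ (λ M k → (M [ k ↦ x ]) l) mems (cong ∣_∣ count₂)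

      other : ∀ l → suc i ≢ l → mem s₃ l ≡ mem s l
      other l ≢l = trans (at l) (update-other (mem s) (suc i) ≢l)

      new : mem s₃ (suc i) ≡ x
      new = trans (at (suc i)) (update-same (mem s) (suc i))

      finished : OuterStep i s s₃
      finished = record
        { next  = record
          { coeffs  = λ l l≤i → trans (other l (ℕₚ.<⇒≢ (s≤s l≤i) ∘ sym)) (coeffs l (ℕₚ.m≤n⇒m≤1+n l≤i))
          ; count   = cong₂ _-_ count₂ one₂
          ; z₀      = trans (regs₂ 2) z₀
          ; one     = one₂
          ; residue = residue′
          ; budget   = budget′
          ; i≤V     = ℕₚ.≤-trans (ℕₚ.n≤1+n i) i≤V
          }
        ; regs  = λ l → regs₂ (2 + l)
        ; other = other
        ; coord = subst (InRange i) (sym new) x-range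
        ; total = trans (cong₂ (λ α y → α * y ℤ.+ β′) (sym coeff) new)
            (trans (undo (reg s₂ 11) (reg s₂ 7 * x)) β₂)
        }
        where
        undo : ∀ β y → y ℤ.+ (β - y) ≡ β
        undo = solve-∀

    -- The inner loop makes `suc i` passes; padding to `n` gives all outer passes the same budget.
    body-runs : ∀ {n} → suc i ℕ.≤ n →
      Runs (outerPre ⨾ (innerLoop ⨾ outerPost)) s (6 + (loopCost innerCost n + 20)) (OuterStep i s)
    body-runs i<n = runs-⨾ (runs-straight outerPre pre-small)
      λ { refl → runs-⨾ (runs-⇒ (loopCost-mono innerCost i<n) (λ P → P) (inner-runs i start))
      λ P → runs-⇒ ℕₚ.≤-refl (λ { refl → finished P }) (runs-straight outerPost (post-small P)) }

  -- Relates loop entry to loop exit: `total` telescopes over the passes, and `above` protects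
  -- finished coordinates from later ones.
  record OuterPost (i : ℕ) (s s′ : State) : Set where
    field
      regs    : Unchanged≥ 12 s s′
      first   : mem s′ 0 ≡ mem s 0
      above   : ∀ l → i ℕ.< l → mem s′ l ≡ mem s l
      coord   : ∀ l → l ℕ.< i → InRange l (mem s′ (suc l))
      residue : ∃[ γ ] reg s′ 11 ≡ γ * + a 0
      total   : sumℤ {i} ((λ l → + a (suc l) * mem s′ (suc l)) ∘ toℕ) ℤ.+ reg s′ 11 ≡ reg s 11
      rest    : Fits 4 (reg s′ 11)

  outerCost : ℕ → ℕ
  outerCost n = 6 + (loopCost innerCost n + 20)

  outer-runs : ∀ n i {s} → i ℕ.≤ n → OuterInv i s →
    Runs outerLoop s (loopCost (outerCost n) i) (OuterPost i s)
  outer-runs n zero {s} _ I = runs-stop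
    (small (subst (Fits 0) (sym count) fits-0)) (ℤₚ.≤-reflexive count) record
      { regs    = λ _ → refl
      ; first   = refl
      ; above   = λ _ _ → refl
      ; coord   = λ _ ()
      ; residue = residue
      ; total   = ℤₚ.+-identityˡ (reg s 11)
      ; rest    = fits (ℕₚ.≤-trans (ℕₚ.m≤m+n ∣ reg s 11 ∣ _) budget)
      }
    where open OuterInv I
  outer-runs n (suc i) {s} i<n I = runs-step
    (small (subst (Fits 1) (sym count) (fits-nat i≤V)))
    (subst (0ℤ <_) (sym count) (+<+ (s≤s z≤n)))
    (OuterBody.body-runs I i<n)
    λ {s₁} P → runs-⇒ ℕₚ.≤-refl (combine P) (outer-runs n i (ℕₚ.<⇒≤ i<n) (OuterStep.next P))
    where
    open OuterInv I
    combine : ∀ {s₁ s₂} → OuterStep i s s₁ → OuterPost i s₁ s₂ → OuterPost (suc i) s s₂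
    combine {s₁} {s₂} P Q = record
      { regs    = λ l → trans (Q.regs l) (P.regs l)
      ; first   = trans Q.first (P.other 0 λ ())
      ; above   = λ l i<l → trans (Q.above l (ℕₚ.<⇒≤ i<l)) (P.other l (ℕₚ.<⇒≢ i<l))
      ; coord   = coord
      ; residue = Q.residue
      ; total   = begin
          sumℤ {suc i} (h ∘ toℕ) ℤ.+ reg s₂ 11
            ≡⟨ cong (ℤ._+ reg s₂ 11) (sumℤ-last i h) ⟩
          sumℤ {i} (h ∘ toℕ) ℤ.+ h i ℤ.+ reg s₂ 11
            ≡⟨ shuffle (sumℤ {i} (h ∘ toℕ)) (h i) (reg s₂ 11) ⟩
          h i ℤ.+ (sumℤ {i} (h ∘ toℕ) ℤ.+ reg s₂ 11)
            ≡⟨ cong₂ ℤ._+_ (cong (+ a (suc i) *_) kept) Q.total ⟩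
          + a (suc i) * mem s₁ (suc i) ℤ.+ reg s₁ 11
            ≡⟨ P.total ⟩
          reg s 11 ∎
      ; rest    = Q.rest
      }
      where
      module P = OuterStep P
      module Q = OuterPost Q
      open ≡-Reasoning
      h : ℕ → ℤ
      h l = + a (suc l) * mem s₂ (suc l)
      kept : mem s₂ (suc i) ≡ mem s₁ (suc i)
      kept = Q.above (suc i) (ℕₚ.n<1+n i)
      shuffle : ∀ x y z → x ℤ.+ y ℤ.+ z ≡ y ℤ.+ (x ℤ.+ z)
      shuffle = solve-∀
      coord : ∀ l → l ℕ.< suc i → InRange l (mem s₂ (suc l))
      coord l (s≤s l≤i) with ℕₚ.m≤n⇒m<n∨m≡n l≤i
      ... | inj₁ l<i  = Q.coord l l<i
      ... | inj₂ refl = subst (InRange i) (sym kept) P.coord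

  -- Correctness of the whole program

  record Solution (top : ℕ) (b : ℤ) (s : State) : Set where
    field
      length≡ : reg s 0 ≡ + suc top
      coord   : ∀ l → l ℕ.< top → InRange l (mem s (suc l))
      total   : + a 0 * mem s 0 ℤ.+ sumℤ {top} ((λ l → + a (suc l) * mem s (suc l)) ∘ toℕ) ≡ b

  solverCost : ℕ → ℕ
  solverCost n = 7 + (loopCost (outerCost n) n + 8)

  module Main {top b s} (len : reg s 0 ≡ + suc (suc top)) (z₀ : reg s 12 ≡ 0ℤ)
              (coeffs : ∀ l → l ℕ.≤ top → mem s l ≡ + a l) (rhs : mem s (suc top) ≡ b)
              (b≤V : ∣ b ∣ ℕ.≤ V) (len≤V : suc (suc top) ℕ.≤ V) (coprime : f top ≡ 1) where

    n≡ : reg s 0 - 1ℤ ≡ + suc top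
    n≡ = cong (_- 1ℤ) len

    β≡ : mem s ∣ reg s 0 - 1ℤ ∣ ≡ b
    β≡ = trans (cong (mem s ∘ ∣_∣) n≡) rhs

    s₁ : State
    s₁ = exec solverPre s

    fn : Fits 1 (reg s 0 - 1ℤ)
    fn = subst (Fits 1) (sym n≡) (fits-nat (ℕₚ.<⇒≤ len≤V))

    pre-small : All Small (operands solverPre s)
    pre-small =
      small fits-1 ∷
      small (subst (Fits 1) (sym len) (fits-nat len≤V)) ∷ small fits-1 ∷
      small fn ∷ small fβ ∷
      small fn ∷ small fits-1 ∷ []
      where
      fβ : Fits 1 (mem s ∣ reg s 0 - 1ℤ ∣)
      fβ = fits (ℕₚ.≤-trans (ℕₚ.≤-reflexive (cong ∣_∣ β≡))
        (ℕₚ.≤-trans b≤V (ℕₚ.≤-reflexive (sym (ℕₚ.*-identityʳ V)))))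

    start : OuterInv top s₁
    start = record
      { coeffs  = coeffs
      ; count   = cong (_- 1ℤ) n≡
      ; z₀      = z₀
      ; one     = refl
      -- Coprimality enters here: `f top` is 1, so it divides any `b`.
      ; residue = b , trans β≡ (trans (sym (ℤₚ.*-identityʳ b)) (cong (λ g → b * + g) (sym coprime)))
      -- `V ^ 4` has room for `b` and for `top` changes of size `V * V`, both parts being at most
      -- `V ^ 3`.
      ; budget  = sum-fits 3 3
          (begin
            ∣ mem s ∣ reg s 0 - 1ℤ ∣ ∣  ≡⟨ cong ∣_∣ β≡ ⟩
            ∣ b ∣                       ≤⟨ b≤V ⟩
            V                           ≡⟨ ℕₚ.*-identityʳ V ⟨
            V ^ 1                       ≤⟨ ℕₚ.^-monoʳ-≤ V (s≤s (z≤n {2})) ⟩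
            V ^ 3                       ∎)
          (begin
            top ℕ.* (V ℕ.* V)  ≤⟨ ℕₚ.*-monoˡ-≤ (V ℕ.* V) top≤V ⟩
            V ℕ.* (V ℕ.* V)    ≡⟨ cong (λ w → V ℕ.* (V ℕ.* w)) (ℕₚ.*-identityʳ V) ⟨
            V ^ 3              ∎)
      ; i≤V     = top≤V
      }
      where
      open ℕₚ.≤-Reasoning
      top≤V : top ℕ.≤ V
      top≤V = ℕₚ.≤-trans (ℕₚ.≤-trans (ℕₚ.n≤1+n top) (ℕₚ.n≤1+n (suc top))) len≤V

    module _ {s₂} (P : OuterPost top s₁ s₂) where
      open OuterPost P

      z₂ : reg s₂ 12 ≡ 0ℤ
      z₂ = trans (regs 0) z₀

      first₂ : mem s₂ ∣ reg s₂ 12 ∣ ≡ + a 0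
      first₂ = trans (cong (mem s₂ ∘ ∣_∣) z₂) (trans first (coeffs 0 z≤n))

      x₀ : ℤ
      x₀ = reg s₂ 11 ÷ mem s₂ ∣ reg s₂ 12 ∣

      post-small : All Small (operands solverPost s₂)
      post-small =
        small f₁₂ ∷ small fa ∷
        small rest ∷ small fa ∷
        small f₁₂ ∷ small (fits-÷ {y = mem s₂ ∣ reg s₂ 12 ∣} rest) ∷
        small (subst (Fits 1) (sym (regs 2)) fn) ∷ small f₁₂ ∷ []
        where
        f₁₂ = subst (Fits 0) (sym z₂) fits-0
        fa  = subst (Fits 1) (sym first₂) (fits-nat (a≤V 0))

      s₃ : State
      s₃ = exec solverPost s₂

      at : ∀ l → mem s₃ l ≡ (mem s₂ [ 0 ↦ x₀ ]) l
      at l = cong (λ k → (mem s₂ [ k ↦ x₀ ]) l) (cong ∣_∣ z₂)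

      -- The final residue is a multiple of `a 0`, so the last division is exact.
      a₀x₀≡ : + a 0 * x₀ ≡ reg s₂ 11
      a₀x₀≡ = begin
        + a 0 * x₀     ≡⟨ cong (+ a 0 *_) (trans (cong₂ _÷_ (proj₂ residue) first₂) (÷-cancel γ a₀>0)) ⟩
        + a 0 * γ      ≡⟨ ℤₚ.*-comm (+ a 0) γ ⟩
        γ * + a 0      ≡⟨ proj₂ residue ⟨
        reg s₂ 11      ∎
        where
        open ≡-Reasoning
        γ = proj₁ residue

      finished : Solution top b s₃
      finished = record
        { length≡ = trans (+-zero z₂) (trans (regs 2) n≡)
        ; coord   = λ l l<top → subst (InRange l) (sym (at (suc l))) (coord l l<top)
        ; total   = begin
            + a 0 * mem s₃ 0 ℤ.+ sumℤ {top} (h s₃ ∘ toℕ)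
              ≡⟨ cong₂ ℤ._+_ (trans (cong (+ a 0 *_) (at 0)) a₀x₀≡)
                   (sum-cong-≗ ℤₚ.+-0-monoid {top} λ i → cong (+ a (suc (toℕ i)) *_) (at (suc (toℕ i)))) ⟩
            reg s₂ 11 ℤ.+ sumℤ {top} (h s₂ ∘ toℕ)
              ≡⟨ ℤₚ.+-comm (reg s₂ 11) _ ⟩
            sumℤ {top} (h s₂ ∘ toℕ) ℤ.+ reg s₂ 11
              ≡⟨ total ⟩
            reg s₁ 11
              ≡⟨ β≡ ⟩
            b ∎
        }
        where
        open ≡-Reasoning
        h : State → ℕ → ℤ
        h s l = + a (suc l) * mem s (suc l)

    solver-runs : Runs solver s (solverCost top) (Solution top b)
    solver-runs = runs-⨾ (runs-straight solverPre pre-small)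
      λ { refl → runs-⨾ (outer-runs top top ℕₚ.≤-refl start)
      λ P → runs-⇒ ℕₚ.≤-refl (λ { refl → finished P }) (runs-straight solverPost (post-small P)) }

-- Closed costs, input size and encoding

loopCost-closed : ∀ c n → loopCost c n ≡ suc (n ℕ.* suc c)
loopCost-closed c zero    = refl
loopCost-closed c (suc n) = cong suc (trans (cong (c ℕ.+_) (loopCost-closed c n)) (ℕₚ.+-suc c (n ℕ.* suc c)))

-- The expansion of solverCost S * L.
timeBound : Polynomial
timeBound = 32 ∷ 184 ∷ 306 ∷ 420 ∷ 368 ∷ []

-- The induction copies the recursion defining `⌈log₂_⌉`, hence the explicit accessibility proof.
n≤2^⌈log₂n⌉ : ∀ n → n ℕ.≤ 2 ^ ⌈log₂ n ⌉
n≤2^⌈log₂n⌉ n = go n (<-wellFounded n)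
  where
  open ℕₚ.≤-Reasoning
  go : ∀ n (rec : Acc ℕ._<_ n) → n ℕ.≤ 2 ^ Log.⌈log2⌉ n rec
  go zero          _        = z≤n
  go (suc zero)    _        = ℕₚ.≤-refl
  go (suc (suc n)) (acc rs) = begin
    suc (suc n)                            ≡⟨ cong (suc ∘ suc) (ℕₚ.⌊n/2⌋+⌈n/2⌉≡n n) ⟨
    suc (suc (ℕ.⌊ n /2⌋ + h))              ≤⟨ s≤s (s≤s (ℕₚ.+-monoˡ-≤ h (ℕₚ.⌊n/2⌋≤⌈n/2⌉ n))) ⟩
    suc (suc (h + h))                      ≡⟨ double h ⟩
    2 ℕ.* suc h                            ≤⟨ ℕₚ.*-monoʳ-≤ 2 (go (suc h) (rs (ℕₚ.⌈n/2⌉<n n))) ⟩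
    2 ^ Log.⌈log2⌉ (suc (suc n)) (acc rs)  ∎
    where
    h = ℕ.⌈ n /2⌉
    double : ∀ h → suc (suc (h + h)) ≡ 2 ℕ.* suc h
    double = ℕ-Ring.solve-∀

∣z∣≤2^bits : ∀ z → ∣ z ∣ ℕ.≤ 2 ^ bits z
∣z∣≤2^bits z = begin
  ∣ z ∣                      ≤⟨ ℕₚ.n≤1+n ∣ z ∣ ⟩
  suc ∣ z ∣                  ≤⟨ n≤2^⌈log₂n⌉ (suc ∣ z ∣) ⟩
  2 ^ ⌈log₂ suc ∣ z ∣ ⌉      ≤⟨ ℕₚ.^-monoʳ-≤ 2 (ℕₚ.n≤1+n ⌈log₂ suc ∣ z ∣ ⌉) ⟩
  2 ^ bits z                 ∎
  where open ℕₚ.≤-Reasoning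

-- Addresses past the end read zero, so the bound covers the whole memory.
cells-bounded : ∀ zs j → ∣ cells zs j ∣ ℕ.≤ 2 ^ size zs
cells-bounded []       j       = z≤n
cells-bounded (z ∷ zs) zero    = ℕₚ.≤-trans (∣z∣≤2^bits z) (ℕₚ.^-monoʳ-≤ 2 (ℕₚ.m≤m+n (bits z) (size zs)))
cells-bounded (z ∷ zs) (suc j) = ℕₚ.≤-trans (cells-bounded zs j) (ℕₚ.^-monoʳ-≤ 2 (ℕₚ.m≤n+m (size zs) (bits z)))

length≤size : ∀ zs → length zs ℕ.≤ size zs
length≤size []       = z≤n
length≤size (z ∷ zs) = s≤s (ℕₚ.≤-trans (length≤size zs) (ℕₚ.m≤n+m (size zs) _))

n≤2^n : ∀ n → n ℕ.≤ 2 ^ n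
n≤2^n zero    = z≤n
n≤2^n (suc n) = ℕₚ.+-mono-≤ (ℕₚ.m^n>0 2 n) (ℕₚ.≤-trans (n≤2^n n) (ℕₚ.m≤m+n (2 ^ n) 0))

cells-encode : ∀ {n} (A : Vector ℤ n) b i → cells (encode A b) (toℕ i) ≡ A i
cells-encode A b Fin.zero    = refl
cells-encode A b (Fin.suc i) = cells-encode (A ∘ Fin.suc) b i

cells-encode-last : ∀ {n} (A : Vector ℤ n) b → cells (encode A b) n ≡ b
cells-encode-last {zero}  A b = refl
cells-encode-last {suc n} A b = cells-encode-last (A ∘ Fin.suc) b

length-encode : ∀ {n} (A : Vector ℤ n) b → length (encode A b) ≡ suc n
length-encode {zero}  A b = refl
length-encode {suc n} A b = cong suc (length-encode (A ∘ Fin.suc) b)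

lookup-toList : ∀ n (g : ℕ → ℤ) (i : Fin (length (toList {n = n} (g ∘ toℕ)))) →
  g (toℕ i) ≡ lookup (toList {n = n} (g ∘ toℕ)) i
lookup-toList (suc n) g Fin.zero    = refl
lookup-toList (suc n) g (Fin.suc i) = lookup-toList n (g ∘ suc) i

toℕ-inject! : ∀ {n} {i : Fin (suc n)} (j : Fin.Fin′ i) → toℕ (Fin.inject! j) ≡ toℕ j
toℕ-inject! {suc n} {Fin.suc i} Fin.zero    = refl
toℕ-inject! {suc n} {Fin.suc i} (Fin.suc j) = cong suc (toℕ-inject! j)

-- `gcdᵛ` folds from the right and the program from the left; associativity of gcd moves the first
-- entry out.
prefixGcdℕ-head : ∀ a k → prefixGcdℕ a (suc k) ≡ ℕ.gcd (a 0) (prefixGcdℕ (a ∘ suc) k)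
prefixGcdℕ-head a zero    = refl
prefixGcdℕ-head a (suc k) = trans (cong (λ g → ℕ.gcd g (a (suc (suc k)))) (prefixGcdℕ-head a k))
  (ℕ.gcd-assoc (a 0) (prefixGcdℕ (a ∘ suc) k) (a (suc (suc k))))

gcdᵛ≡prefixGcdℕ : ∀ k (v : Vector ℤ (suc k)) (a : ℕ → ℕ) → (∀ j → ∣ v j ∣ ≡ a (toℕ j)) →
  gcdᵛ v ≡ + prefixGcdℕ a k
gcdᵛ≡prefixGcdℕ zero    v a v≡a = cong +_ (trans (ℕ.gcd-identityʳ ∣ v Fin.zero ∣) (v≡a Fin.zero))
gcdᵛ≡prefixGcdℕ (suc k) v a v≡a = cong +_ (trans
  (cong₂ ℕ.gcd (v≡a Fin.zero) (cong ∣_∣ (gcdᵛ≡prefixGcdℕ k (v ∘ Fin.suc) (a ∘ suc) (v≡a ∘ Fin.suc))))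
  (sym (prefixGcdℕ-head a k)))

sumℤ-mono : ∀ {n} (u v : Vector ℤ n) → (∀ i → u i ≤ v i) → sumℤ u ≤ sumℤ v
sumℤ-mono {zero}  u v u≤v = ℤₚ.≤-refl
sumℤ-mono {suc n} u v u≤v =
  ℤₚ.+-mono-≤ (u≤v Fin.zero) (sumℤ-mono (u ∘ Fin.suc) (v ∘ Fin.suc) (u≤v ∘ Fin.suc))

-1<⇒0≤ : ∀ {i} → -1ℤ < i → 0ℤ ≤ i
-1<⇒0≤ {+ n}      _ = +≤+ z≤n
-1<⇒0≤ { -[1+ n ]} (ℤ.-<- ())

-- Solving a given instance: nonnegativity and running time

module Instance (m : ℕ) (A : Vector ℤ (2 + m)) (b : ℤ)
                (A>0 : ∀ i → 0ℤ < A i) (gcd≡1 : gcdᵛ A ≡ 1ℤ) (G<b : G A < b)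
                -- A variable, because unfolding the size makes conversion checking diverge.
                (S : ℕ) (size≡S : size (encode A b) ≡ S) where

  zs : List ℤ
  zs = encode A b

  instance
    S≢0 : NonZero S
    S≢0 = subst NonZero size≡S _

  top : ℕ
  top = suc m

  -- The cells hold the coefficients followed by `b`, so index `2 + m` gives the absolute value of
  -- `b` and one bound serves both.
  a : ℕ → ℕ
  a j = ∣ cells zs j ∣

  a≡A : ∀ i → + a (toℕ i) ≡ A i
  a≡A i = trans (cong (λ z → + ∣ z ∣) (cells-encode A b i)) (ℤₚ.0≤i⇒+∣i∣≡i (ℤₚ.<⇒≤ (A>0 i)))

  a₀>0 : 0 ℕ.< a 0
  a₀>0 = ℤₚ.drop‿+<+ (subst (0ℤ <_) (sym (a≡A Fin.zero)) (A>0 Fin.zero))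

  open Bounded S using (V; L; module Runs)

  a≤V : ∀ j → a j ℕ.≤ V
  a≤V j = subst (λ S → a j ℕ.≤ 2 ^ S) size≡S (cells-bounded zs j)

  open Solve S a a≤V a₀>0

  ∣A∣≡a : ∀ i → ∣ A i ∣ ≡ a (toℕ i)
  ∣A∣≡a i = cong ∣_∣ (sym (a≡A i))

  prefixGcd≡ : ∀ i → prefixGcd A i ≡ + f (toℕ i)
  prefixGcd≡ i = gcdᵛ≡prefixGcdℕ (toℕ i) (λ j → A (Fin.inject! j)) a λ j →
    trans (∣A∣≡a (Fin.inject! j)) (cong a (toℕ-inject! j))

  coprime : f top ≡ 1
  coprime = ℤₚ.+-injective (trans (sym (gcdᵛ≡prefixGcdℕ top A a ∣A∣≡a)) gcd≡1)

  len≤S : suc (suc top) ℕ.≤ S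
  len≤S = subst₂ ℕ._≤_ (length-encode A b) size≡S (length≤size zs)

  coeffs : ∀ l → l ℕ.≤ top → cells zs l ≡ + a l
  coeffs l l≤top = subst (λ l → cells zs l ≡ + a l) (toℕ-fromℕ< (s≤s l≤top))
    (trans (cells-encode A b i) (sym (a≡A i)))
    where i = Fin.fromℕ< (s≤s l≤top)

  b≤V : ∣ b ∣ ℕ.≤ V
  b≤V = subst (λ z → ∣ z ∣ ℕ.≤ V) (cells-encode-last A b) (a≤V (2 + m))

  outcome : Bounded.Runs S solver (initial zs) (solverCost top) (Solution top b)
  outcome = Main.solver-runs (cong +_ (length-encode A b)) refl coeffs (cells-encode-last A b)
    b≤V (ℕₚ.≤-trans len≤S (n≤2^n S)) coprime

  open Runs outcome public
  open Solution ends

  x : Vector ℤ (2 + m)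
  x i = mem end (toℕ i)

  Ax≡b : A ∙ x ≡ b
  Ax≡b = trans (sym (cong₂ ℤ._+_ (cong (_* mem end 0) (a≡A Fin.zero))
    (sum-cong-≗ ℤₚ.+-0-monoid {top} λ i → cong (_* mem end (suc (toℕ i))) (a≡A (Fin.suc i))))) total

  tailA tailAx steps : Vector ℤ top
  tailA i  = A (Fin.suc i)
  tailAx i = A (Fin.suc i) * x (Fin.suc i)
  steps i  = A (Fin.suc i) * (prefixGcd A (Fin.inject₁ i) ÷ prefixGcd A (Fin.suc i))

  x-range : ∀ i → InRange (toℕ i) (x (Fin.suc i))
  x-range i = coord (toℕ i) (toℕ<n i)

  -- Each coordinate plus one is at most its quotient of prefix gcds; multiply by the positive
  -- coefficient and sum.
  tail-bound : sumℤ tailAx ℤ.+ sumℤ tailA ≤ sumℤ steps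
  tail-bound = subst (_≤ sumℤ steps) (∑-distrib-+ ℤₚ.+-0-commutativeMonoid tailAx tailA)
    (sumℤ-mono _ steps bounded)
    where
    bounded : ∀ i → tailAx i ℤ.+ tailA i ≤ steps i
    bounded i = begin
      A⁺ * y ℤ.+ A⁺              ≡⟨ factor A⁺ y ⟩
      A⁺ * ℤ.suc y               ≤⟨ ℤₚ.*-monoˡ-≤-nonNeg A⁺ {{ℤ.nonNegative (ℤₚ.<⇒≤ (A>0 (Fin.suc i)))}}
                                      (ℤₚ.i<j⇒suc[i]≤j (proj₂ (x-range i))) ⟩
      A⁺ * (+ f (toℕ i) ÷ + f (suc (toℕ i)))
        ≡⟨ cong (A⁺ *_) (cong₂ _÷_
             (trans (prefixGcd≡ (Fin.inject₁ i)) (cong (λ l → + f l) (toℕ-inject₁ i)))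
             (prefixGcd≡ (Fin.suc i))) ⟨
      steps i ∎
      where
      open ℤₚ.≤-Reasoning
      A⁺ y : ℤ
      A⁺ = A (Fin.suc i)
      y  = x (Fin.suc i)
      factor : ∀ a y → a * y ℤ.+ a ≡ a * (1ℤ ℤ.+ y)
      factor = solve-∀

  -- By `tail-bound`, `G A` is at least the tail of `A ∙ x` minus `A₀`. With `G A < b` this leaves
  -- `A₀ x₀ > - A₀`, so the integer `x₀` exceeds -1.
  x₀≥0 : 0ℤ ≤ x Fin.zero
  x₀≥0 = -1<⇒0≤ (ℤₚ.*-cancelˡ-<-nonNeg A₀ {{ℤ.nonNegative (ℤₚ.<⇒≤ (A>0 Fin.zero))}} (begin-strict
    A₀ * -1ℤ                                                ≡⟨ spread A₀ (sumℤ tailA) (sumℤ tailAx) ⟩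
    sumℤ tailAx ℤ.+ sumℤ tailA - sumℤ A - sumℤ tailAx         ≤⟨ ℤₚ.+-monoˡ-≤ _ (ℤₚ.+-monoˡ-≤ _ tail-bound) ⟩
    G A - sumℤ tailAx                                         <⟨ ℤₚ.+-monoˡ-< _ G<b ⟩
    b - sumℤ tailAx                                           ≡⟨ cong (_- sumℤ tailAx) Ax≡b ⟨
    A₀ * x Fin.zero ℤ.+ sumℤ tailAx - sumℤ tailAx             ≡⟨ undo (A₀ * x Fin.zero) (sumℤ tailAx) ⟩
    A₀ * x Fin.zero                                           ∎))
    where
    open ℤₚ.≤-Reasoning
    A₀ : ℤ
    A₀ = A Fin.zero
    spread : ∀ a t y → a * -1ℤ ≡ y ℤ.+ t - (a ℤ.+ t) - y
    spread = solve-∀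
    undo : ∀ y z → y ℤ.+ z - z ≡ y
    undo = solve-∀

  x≥0 : ∀ i → 0ℤ ≤ x i
  x≥0 Fin.zero    = x₀≥0
  x≥0 (Fin.suc i) = proj₁ (x-range i)

  -- Outer, inner and Euclidean passes are each linear in `S`, giving a cubic number of operands;
  -- each costs at most `L`, also linear, whence degree four.
  time-bound : time ℕ.≤ eval timeBound S
  time-bound = begin
    time                                        ≤⟨ time≤ ⟩
    solverCost top ℕ.* L                        ≤⟨ ℕₚ.*-monoˡ-≤ L cost≤ ⟩
    (15 + suc (S ℕ.* (28 + S ℕ.* (41 + S ℕ.* 46)))) ℕ.* L  ≡⟨ expand S ⟩
    eval timeBound S                            ∎
    where
    open ℕₚ.≤-Reasoning
    top≤S : top ℕ.≤ S
    top≤S = ℕₚ.≤-trans (ℕₚ.≤-trans (ℕₚ.n≤1+n top) (ℕₚ.n≤1+n (suc top))) len≤S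
    expand : ∀ S → (15 + suc (S ℕ.* (28 + S ℕ.* (41 + S ℕ.* 46)))) ℕ.* (2 + S ℕ.* 8)
      ≡ 32 + S ℕ.* (184 + S ℕ.* (306 + S ℕ.* (420 + S ℕ.* (368 + S ℕ.* 0))))
    expand = ℕ-Ring.solve-∀
    euclid≡ : ∀ S → 13 + (suc (suc (S + S) ℕ.* 23) + 4) ≡ 41 + S ℕ.* 46
    euclid≡ = ℕ-Ring.solve-∀
    inner≡ : suc innerCost ≡ 41 + S ℕ.* 46
    inner≡ = trans (cong (λ c → 13 + (c + 4)) (loopCost-closed 22 euclidFuel)) (euclid≡ S)
    regroup : ∀ w → 7 + (suc w + 20) ≡ 28 + w
    regroup = ℕ-Ring.solve-∀
    outer≤ : suc (outerCost top) ℕ.≤ 28 + S ℕ.* (41 + S ℕ.* 46)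
    outer≤ = begin
      7 + (loopCost innerCost top + 20)        ≡⟨ cong (λ c → 7 + (c + 20)) (loopCost-closed innerCost top) ⟩
      7 + (suc (top ℕ.* suc innerCost) + 20)   ≡⟨ regroup (top ℕ.* suc innerCost) ⟩
      28 + top ℕ.* suc innerCost               ≤⟨ ℕₚ.+-monoʳ-≤ 28 (ℕₚ.*-mono-≤ top≤S (ℕₚ.≤-reflexive inner≡)) ⟩
      28 + S ℕ.* (41 + S ℕ.* 46)               ∎
    regroup′ : ∀ w → 7 + (suc w + 8) ≡ 15 + suc w
    regroup′ = ℕ-Ring.solve-∀
    cost≤ : solverCost top ℕ.≤ 15 + suc (S ℕ.* (28 + S ℕ.* (41 + S ℕ.* 46)))
    cost≤ = begin
      7 + (loopCost (outerCost top) top + 8)        ≡⟨ cong (λ c → 7 + (c + 8)) (loopCost-closed (outerCost top) top) ⟩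
      7 + (suc (top ℕ.* suc (outerCost top)) + 8)   ≡⟨ regroup′ (top ℕ.* suc (outerCost top)) ⟩
      15 + suc (top ℕ.* suc (outerCost top))        ≤⟨ ℕₚ.+-monoʳ-≤ 15 (s≤s (ℕₚ.*-mono-≤ top≤S outer≤)) ⟩
      15 + suc (S ℕ.* (28 + S ℕ.* (41 + S ℕ.* 46))) ∎

  output : Contains end (toList x)
  output = trans length≡ (cong +_ (sym (length-tabulate x))) , lookup-toList (2 + m) (mem end)

corollary1p1 : Σ[ p ∈ Program ] Σ[ q ∈ Polynomial ]
    (∀ (m : ℕ) (A : Vector ℤ (2 + m)) (b : ℤ) →
    (∀ i → 0ℤ < A i) →
    gcdᵛ A ≡ 1ℤ →
    TrivialKernelCone A →
    G A < b →
    Σ[ x ∈ Vector ℤ (2 + m) ]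
    ((∀ i → 0ℤ ≤ x i) × A ∙ x ≡ b ×
    p computes toList x from encode A b within eval q (size (encode A b))))
corollary1p1 = solver , timeBound , λ m A b A>0 gcd≡1 _ G<b →
  -- Only here does the variable `S` become the actual input size.
  let open Instance m A b A>0 gcd≡1 G<b (size (encode A b)) refl
  in x , x≥0 , Ax≡b , end , time , run , time-bound , output
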